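{- Let $q$ be a prime power and let $1 \leq k < n$ be integers. If the statement $B(n,k)$ holds with constant $D_{n,k} \geq 0$, then the statement $A(n,k)$ holds with constant $$C_{n,k} = q^{ -\frac{n}{k} D_{n,k}}.$$
   Context: $\mathbb{F}_q$ is the finite field with $q$ elements ($q$ is fixed), and linear means $\mathbb{F}_q$-linear. For integers $1 \leq k < n$ and $m \geq 1$, a subset $S \subseteq \mathbb{F}_q^n$ is $(k,m)$-Furstenberg if for each $k$-dimensional linear subspace $W$ of $\mathbb{F}_q^n$ there is a translate of $W$ that intersects $S$ in at least $m$ points. For a random variable $R$ taking values in $\mathbb{F}_q^N$, its $q$-ary min-entropy is $\mathbf{H}^q_\infty(R) = -\log_q\left(\max_{w \in \mathbb{F}_q^N} \Pr[R = w]\right)$. Statement $A(n,k)$ holds with constant $C_{n,k}$ if: for every $m$ and every $S \subseteq \mathbb{F}_q^n$ that is $(k,m)$-Furstenberg, $|S| \geq C_{n,k} \cdot m^{n/k}$. Statement $B(n,k)$ holds with constant $D_{n,k}$ if: for all $\delta \in [0,1]$, if $S \subseteq \mathbb{F}_q^n$ has size $|S| = q^{\delta n}$, then there exists an onto linear map $\varphi : \mathbb{F}_q^n \to \mathbb{F}_q^{n-k}$ such that $\mathbf{H}^q_\infty(\varphi(U_S)) \geq \delta(n-k) - D_{n,k}$, where $U_S$ is a random variable distributed uniformly over $S$. -}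

module Defs where

open import Level using (0ℓ)
open import Function.Base using (_∘_)
open import Function.Bundles using (_↔_; _↣_; Inverse; Injection)
open import Function.Definitions using (Surjective)
open import Data.Empty using (⊥-elim)
open import Data.Bool.Base using (if_then_else_)
open import Data.Product using (Σ; ∃; ∃-syntax; _×_; _,_; proj₁; proj₂)
open import Data.Sum.Base using (_⊎_; inj₁; inj₂; [_,_]′)
open import Data.Nat as ℕ using (ℕ; zero; suc; NonTrivial)
import Data.Nat.Properties as ℕ
open import Data.Nat.Primality using (Prime)
open import Data.Integer as ℤ using (ℤ; +_; -[1+_])
import Data.Integer.Properties as ℤ
open import Data.Rational as ℚ
  using (ℚ; 0ℚ; 1ℚ; _/_; ↥_; ↧_; ↧ₙ_; _<_; _≤_; _*_; Positive; NonNegative)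
open import Data.Rational.Properties as ℚ hiding (_≟_)
import Data.Rational.Unnormalised as ℚᵘ
import Data.Rational.Unnormalised.Properties as ℚᵘ
open import Data.Fin.Base using (Fin; zero; suc)
import Data.Fin.Properties as Fin
open import Data.List.Base as List using (List; []; _∷_)
open import Data.List.Membership.Propositional using (_∈_)
import Data.List.Membership.Propositional.Properties as ∈
open import Data.List.Relation.Unary.Any as Any using (here)
open import Data.List.Relation.Unary.Unique.Propositional using (Unique)
open import Relation.Binary.Bundles using (DecTotalOrder)
open import Data.List.Extrema (DecTotalOrder.totalOrder ℚ.≤-decTotalOrder) using (max; v≤max⁺)
open import Data.Vec.Base as Vec using (Vec; []; _∷_)
open import Data.Vec.Relation.Unary.All using (All)
import Data.Vec.Properties as Vec
open import Relation.Nullary using (¬_; yes; no; does)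
open import Relation.Unary using (Pred)
open import Relation.Binary.Definitions using (DecidableEquality)
open import Relation.Binary.PropositionalEquality
open import Algebra.Bundles using (CommutativeRing)
open import Algebra.Structures using (IsCommutativeRing)
open import Algebra.Module.Bundles.Raw using (RawLeftModule)
import Algebra.Module.Morphism.Structures as Morphism
import Algebra.Properties.CommutativeMonoid.Sum as Sum
open import Algebra.Properties.Semiring.Exp
  (CommutativeRing.semiring ℚ.+-*-commutativeRing) using (_^_; ^-assocʳ)

open Sum ℚ.+-0-commutativeMonoid using (sum)

private
  variable
    p q r t : ℚ

fromℕ : ℕ → ℚ
fromℕ n = + n / 1

toℚᵘ-fromℕ : ∀ n → ℚ.toℚᵘ (fromℕ n) ℚᵘ.≃ ℚᵘ.mkℚᵘ (+ n) 0
toℚᵘ-fromℕ n = toℚᵘ-fromℚᵘ (ℚᵘ.mkℚᵘ (+ n) 0)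

fromℕ-mono : ∀ {m n} → m ℕ.≤ n → fromℕ m ≤ fromℕ n
fromℕ-mono {m} {n} m≤n = toℚᵘ-cancel-≤
  (ℚᵘ.≤-respˡ-≃ (ℚᵘ.≃-sym (toℚᵘ-fromℕ m))
    (ℚᵘ.≤-respʳ-≃ (ℚᵘ.≃-sym (toℚᵘ-fromℕ n))
      (ℚᵘ.*≤* (ℤ.*-monoʳ-≤-nonNeg (+ 1) (ℤ.+≤+ m≤n)))))

fromℕ-suc : ∀ n → fromℕ (suc n) ≡ 1ℚ ℚ.+ fromℕ n
fromℕ-suc n = toℚᵘ-injective (ℚᵘ.≃-trans (toℚᵘ-fromℕ (suc n))
  (ℚᵘ.≃-trans (ℚᵘ.*≡* eq)
    (ℚᵘ.≃-sym (ℚᵘ.≃-trans (toℚᵘ-homo-+ 1ℚ (fromℕ n))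
      (ℚᵘ.+-congʳ ℚᵘ.1ℚᵘ (toℚᵘ-fromℕ n))))))
  where
  eq : + suc n ℤ.* + 1 ≡ (+ 1 ℤ.* + 1 ℤ.+ + n ℤ.* + 1) ℤ.* + 1
  eq = cong (ℤ._* + 1) (cong (λ z → + 1 ℤ.+ z) (sym (ℤ.*-identityʳ (+ n))))

n*1/n : ∀ n .{{_ : ℕ.NonZero n}} → fromℕ n * (+ 1 / n) ≡ 1ℚ
n*1/n n@(suc n-1) = toℚᵘ-injective (ℚᵘ.≃-trans (toℚᵘ-homo-* (fromℕ n) (+ 1 / n))
  (ℚᵘ.≃-trans (ℚᵘ.*-cong (toℚᵘ-fromℕ n) (toℚᵘ-fromℚᵘ (ℚᵘ.mkℚᵘ (+ 1) n-1)))
    (ℚᵘ.*≡* eq)))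
  where
  eq : (+ n ℤ.* + 1) ℤ.* + 1 ≡ + 1 ℤ.* (+ 1 ℤ.* + n)
  eq = trans (ℤ.*-identityʳ (+ n ℤ.* + 1)) (trans (ℤ.*-identityʳ (+ n))
         (sym (trans (ℤ.*-identityˡ (+ 1 ℤ.* + n)) (ℤ.*-identityˡ (+ n)))))

archimedean : ∀ p → ∃[ n ] p ≤ fromℕ n
archimedean p = ℤ.∣ ↥ p ∣ , toℚᵘ-cancel-≤
  (ℚᵘ.≤-respʳ-≃ (ℚᵘ.≃-sym (toℚᵘ-fromℕ ℤ.∣ ↥ p ∣)) (ℚᵘ.*≤* bound))
  where
  i≤∣i∣ : ∀ i → i ℤ.≤ + ℤ.∣ i ∣
  i≤∣i∣ (+ n)    = ℤ.≤-refl
  i≤∣i∣ -[1+ n ] = ℤ.-≤+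
  1≤↧ : ∀ p → + 1 ℤ.≤ ℚᵘ.↧ (ℚ.toℚᵘ p)
  1≤↧ (ℚ.mkℚ _ d _) = ℤ.+≤+ (ℕ.s≤s ℕ.z≤n)
  ↥≡ : ∀ p → ℚᵘ.↥ (ℚ.toℚᵘ p) ≡ ↥ p
  ↥≡ (ℚ.mkℚ _ _ _) = refl
  bound : ℚᵘ.↥ (ℚ.toℚᵘ p) ℤ.* + 1 ℤ.≤ + ℤ.∣ ↥ p ∣ ℤ.* ℚᵘ.↧ (ℚ.toℚᵘ p)
  bound = ℤ.≤-trans
    (ℤ.≤-trans (ℤ.≤-reflexive (trans (ℤ.*-identityʳ _) (↥≡ p))) (i≤∣i∣ (↥ p)))
    (ℤ.≤-trans (ℤ.≤-reflexive (sym (ℤ.*-identityʳ _)))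
      (ℤ.*-monoˡ-≤-nonNeg (+ ℤ.∣ ↥ p ∣) (1≤↧ p)))

0≤1 : 0ℚ ≤ 1ℚ
0≤1 = nonNegative⁻¹ 1ℚ

p-1<p : ∀ p → p ℚ.- 1ℚ < p
p-1<p p = subst (p ℚ.- 1ℚ <_) (+-identityʳ p) (+-monoʳ-< p (negative⁻¹ (ℚ.- 1ℚ)))

p<p+1 : ∀ p → p < p ℚ.+ 1ℚ
p<p+1 p = subst (_< p ℚ.+ 1ℚ) (+-identityʳ p) (+-monoʳ-< p (positive⁻¹ 1ℚ))

endpoint≤ : ∀ {a x b} t → a ≤ x → x ≤ b → a * t ≤ x * t ⊎ b * t ≤ x * t
endpoint≤ t a≤x x≤b with ≤-total 0ℚ t
... | inj₁ 0≤t = inj₁ (*-monoʳ-≤-nonNeg t {{ℚ.nonNegative 0≤t}} a≤x)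
... | inj₂ t≤0 = inj₂ (*-monoʳ-≤-nonPos t {{ℚ.nonPositive t≤0}} x≤b)

≤endpoint : ∀ {a x b} t → a ≤ x → x ≤ b → x * t ≤ a * t ⊎ x * t ≤ b * t
≤endpoint t a≤x x≤b with ≤-total 0ℚ t
... | inj₁ 0≤t = inj₂ (*-monoʳ-≤-nonNeg t {{ℚ.nonNegative 0≤t}} x≤b)
... | inj₂ t≤0 = inj₁ (*-monoʳ-≤-nonPos t {{ℚ.nonPositive t≤0}} a≤x)

min₄ : ∀ w x y z → ∃[ m ] (m ≤ w × m ≤ x × m ≤ y × m ≤ z ×
         (∀ {l} → l < w → l < x → l < y → l < z → l < m))
min₄ w x y z = wx ℚ.⊓ yz
  , ≤-trans (p⊓q≤p wx yz) (p⊓q≤p w x) , ≤-trans (p⊓q≤p wx yz) (p⊓q≤q w x)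
  , ≤-trans (p⊓q≤q wx yz) (p⊓q≤p y z) , ≤-trans (p⊓q≤q wx yz) (p⊓q≤q y z)
  , λ l<w l<x l<y l<z → glb wx yz (glb w x l<w l<x) (glb y z l<y l<z)
  where
  wx = w ℚ.⊓ x
  yz = y ℚ.⊓ z
  glb : ∀ q r {l} → l < q → l < r → l < q ℚ.⊓ r
  glb q r {l} l<q l<r with ≤-total q r
  ... | inj₁ q≤r = subst (l <_) (sym (p≤q⇒p⊓q≡p q≤r)) l<q
  ... | inj₂ r≤q = subst (l <_) (sym (p≥q⇒p⊓q≡q r≤q)) l<r

max₄ : ∀ w x y z → ∃[ m ] (w ≤ m × x ≤ m × y ≤ m × z ≤ m)
max₄ w x y z = wx ℚ.⊔ yz
  , ≤-trans (p≤p⊔q w x) (p≤p⊔q wx yz) , ≤-trans (p≤q⊔p w x) (p≤p⊔q wx yz)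
  , ≤-trans (p≤p⊔q y z) (p≤q⊔p wx yz) , ≤-trans (p≤q⊔p y z) (p≤q⊔p wx yz)
  where
  wx = w ℚ.⊔ x
  yz = y ℚ.⊔ z

⊔-lub-≤ : p ≤ r → q ≤ r → p ℚ.⊔ q ≤ r
⊔-lub-≤ {p} {r} {q} p≤r q≤r with ≤-total p q
... | inj₁ p≤q = subst (_≤ r) (sym (p≤q⇒p⊔q≡q p≤q)) q≤r
... | inj₂ q≤p = subst (_≤ r) (sym (p≥q⇒p⊔q≡p q≤p)) p≤r

^-nonNeg : ∀ n → 0ℚ ≤ p → 0ℚ ≤ p ^ n
^-nonNeg zero    0≤p = 0≤1
^-nonNeg {p} (suc n) 0≤p =
  nonNegative⁻¹ (p * p ^ n)
    {{nonNeg*nonNeg⇒nonNeg p {{ℚ.nonNegative 0≤p}} (p ^ n) {{ℚ.nonNegative (^-nonNeg n 0≤p)}}}}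

^-monoˡ-≤ : ∀ n → 0ℚ ≤ p → p ≤ q → p ^ n ≤ q ^ n
^-monoˡ-≤ zero    0≤p p≤q = ≤-refl
^-monoˡ-≤ {p} {q} (suc n) 0≤p p≤q = ≤-trans
  (*-monoʳ-≤-nonNeg (p ^ n) {{ℚ.nonNegative (^-nonNeg n 0≤p)}} p≤q)
  (*-monoˡ-≤-nonNeg q {{ℚ.nonNegative (≤-trans 0≤p p≤q)}} (^-monoˡ-≤ n 0≤p p≤q))

^-monoˡ-< : ∀ n .{{_ : ℕ.NonZero n}} → 0ℚ ≤ p → p < q → p ^ n < q ^ n
^-monoˡ-< {p} {q} (suc zero) 0≤p p<q =
  subst₂ _<_ (sym (*-identityʳ p)) (sym (*-identityʳ q)) p<q
^-monoˡ-< {p} {q} (suc n@(suc _)) 0≤p p<q = ≤-<-trans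
  (*-monoʳ-≤-nonNeg (p ^ n) {{ℚ.nonNegative (^-nonNeg n 0≤p)}} (<⇒≤ p<q))
  (*-monoʳ-<-pos q {{ℚ.positive (≤-<-trans 0≤p p<q)}} (^-monoˡ-< n 0≤p p<q))

1≤^ : ∀ n → 1ℚ ≤ p → 1ℚ ≤ p ^ n
1≤^ zero    1≤p = ≤-refl
1≤^ {p} (suc n) 1≤p = ≤-trans 1≤p
  (subst (_≤ p * p ^ n) (*-identityʳ p)
    (*-monoˡ-≤-nonNeg p {{ℚ.nonNegative (≤-trans 0≤1 1≤p)}} (1≤^ n 1≤p)))

^-monoʳ-≤ : ∀ {m n} → 1ℚ ≤ p → m ℕ.≤ n → p ^ m ≤ p ^ n
^-monoʳ-≤ {n = n} 1≤p ℕ.z≤n = 1≤^ n 1≤p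
^-monoʳ-≤ {p} 1≤p (ℕ.s≤s m≤n) =
  *-monoˡ-≤-nonNeg p {{ℚ.nonNegative (≤-trans 0≤1 1≤p)}} (^-monoʳ-≤ 1≤p m≤n)

^-sucʳ-< : ∀ n → 1ℚ < p → p ^ n < p ^ suc n
^-sucʳ-< {p} n 1<p = subst (_< p * p ^ n) (*-identityˡ (p ^ n))
  (*-monoˡ-<-pos (p ^ n) {{ℚ.positive (<-≤-trans (positive⁻¹ 1ℚ) (1≤^ n (<⇒≤ 1<p)))}} 1<p)

1/^*^ : ∀ b .{{_ : ℕ.NonZero b}} n → (+ 1 / b) ^ n * fromℕ b ^ n ≡ 1ℚ
1/^*^ b zero    = refl
1/^*^ b (suc n) = begin
  (x * x ^ n) * (y * y ^ n)  ≡⟨ *-assoc x (x ^ n) _ ⟩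
  x * (x ^ n * (y * y ^ n))  ≡⟨ cong (x *_) (sym (*-assoc (x ^ n) y _)) ⟩
  x * ((x ^ n * y) * y ^ n)  ≡⟨ cong (λ z → x * (z * y ^ n)) (*-comm (x ^ n) y) ⟩
  x * ((y * x ^ n) * y ^ n)  ≡⟨ cong (x *_) (*-assoc y (x ^ n) _) ⟩
  x * (y * (x ^ n * y ^ n))  ≡⟨ cong (λ z → x * (y * z)) (1/^*^ b n) ⟩
  x * (y * 1ℚ)               ≡⟨ cong (x *_) (*-identityʳ y) ⟩
  x * y                      ≡⟨ *-comm x y ⟩
  y * x                      ≡⟨ n*1/n b ⟩
  1ℚ                         ∎
  where
  open ≡-Reasoning
  x = + 1 / b
  y = fromℕ b

1≤fromℕ : ∀ b .{{_ : ℕ.NonZero b}} → 1ℚ ≤ fromℕ b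
1≤fromℕ b@(suc _) = fromℕ-mono {1} {b} (ℕ.s≤s ℕ.z≤n)

1<fromℕ : ∀ b .{{_ : NonTrivial b}} → 1ℚ < fromℕ b
1<fromℕ b@(suc (suc _)) =
  <-≤-trans (p<p+1 1ℚ) (fromℕ-mono {2} {b} (ℕ.s≤s (ℕ.s≤s ℕ.z≤n)))

0≤1/ : ∀ b .{{_ : ℕ.NonZero b}} → 0ℚ ≤ + 1 / b
0≤1/ b = nonNegative⁻¹ (+ 1 / b) {{normalize-nonNeg 1 b}}

n≤b^n : ∀ b .{{_ : NonTrivial b}} n → fromℕ n ≤ fromℕ b ^ n
n≤b^n b zero    = 0≤1
n≤b^n b@(suc (suc _)) (suc n) = begin
  fromℕ (suc n)                    ≡⟨ fromℕ-suc n ⟩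
  1ℚ ℚ.+ fromℕ n                   ≤⟨ +-mono-≤ (1≤^ n (1≤fromℕ b)) (n≤b^n b n) ⟩
  fromℕ b ^ n ℚ.+ fromℕ b ^ n      ≡⟨ (let 1* = sym (*-identityˡ (fromℕ b ^ n)) in cong₂ ℚ._+_ 1* 1*) ⟩
  1ℚ * fromℕ b ^ n ℚ.+ 1ℚ * fromℕ b ^ n
                                   ≡⟨ sym (*-distribʳ-+ (fromℕ b ^ n) 1ℚ 1ℚ) ⟩
  (1ℚ ℚ.+ 1ℚ) * fromℕ b ^ n        ≤⟨ *-monoʳ-≤-nonNeg (fromℕ b ^ n)
                                        {{ℚ.nonNegative (^-nonNeg n (≤-trans 0≤1 (1≤fromℕ b)))}}
                                        (fromℕ-mono {2} {b} (ℕ.s≤s (ℕ.s≤s ℕ.z≤n))) ⟩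
  fromℕ b * fromℕ b ^ n            ∎
  where open ≤-Reasoning

infixr 8 _^ℤ_
_^ℤ_ : (b : ℕ) → .{{_ : ℕ.NonZero b}} → ℤ → ℚ
b ^ℤ (+ n)    = (+ b / 1) ^ n
b ^ℤ -[1+ n ] = (+ 1 / b) ^ suc n

0≤^ℤ : ∀ b .{{_ : ℕ.NonZero b}} i → 0ℚ ≤ b ^ℤ i
0≤^ℤ b (+ n)    = ^-nonNeg n (≤-trans 0≤1 (1≤fromℕ b))
0≤^ℤ b -[1+ n ] = ^-nonNeg (suc n) (0≤1/ b)

^ℤ≤^ : ∀ b .{{_ : ℕ.NonZero b}} {i n} → i ℤ.≤ + n → b ^ℤ i ≤ fromℕ b ^ n
^ℤ≤^ b {+ m}      (ℤ.+≤+ m≤n) = ^-monoʳ-≤ (1≤fromℕ b) m≤n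
^ℤ≤^ b { -[1+ m ]} {n} _ = ≤-trans b⁻ᵐ≤1 (1≤^ n (1≤fromℕ b))
  where
  b⁻ᵐ≤1 : (+ 1 / b) ^ suc m ≤ 1ℚ
  b⁻ᵐ≤1 = subst₂ _≤_ (*-identityʳ _) (1/^*^ b (suc m))
    (*-monoˡ-≤-nonNeg ((+ 1 / b) ^ suc m) {{ℚ.nonNegative (0≤^ℤ b -[1+ m ])}}
      (1≤^ (suc m) (1≤fromℕ b)))

↥≤ : ∀ p n → p ≤ fromℕ n → ↥ p ℤ.≤ + (n ℕ.* ↧ₙ p)
↥≤ p@(ℚ.mkℚ i d _) n p≤n with ℚᵘ.≤-respʳ-≃ (toℚᵘ-fromℕ n) (toℚᵘ-mono-≤ p≤n)
... | ℚᵘ.*≤* le = subst₂ ℤ._≤_ (ℤ.*-identityʳ i) (sym (ℤ.pos-* n (suc d))) le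

<↥ : ∀ p n → fromℕ n < p → + (n ℕ.* ↧ₙ p) ℤ.< ↥ p
<↥ p@(ℚ.mkℚ i d _) n n<p with ℚᵘ.<-respˡ-≃ (toℚᵘ-fromℕ n) (toℚᵘ-mono-< n<p)
... | ℚᵘ.*<* lt = subst₂ ℤ._<_ (sym (ℤ.pos-* n (suc d))) (ℤ.*-identityʳ i) lt

-- Dedekind cuts of ℚ, given by their lower half; locatedness is not required,
-- so constructively these are the bounded lower reals.
record ℝ : Set₁ where
  field
    lower     : Pred ℚ 0ℓ
    inhabited : ∃[ p ] lower p
    bounded   : ∃[ p ] ¬ lower p
    closed    : p < q → lower q → lower p
    rounded   : lower p → ∃[ q ] (p < q × lower q)

open ℝ public using (lower)

-- x < p as real numbers (in particular p is not the least upper bound of x).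
upper : ℝ → Pred ℚ 0ℓ
upper x p = ∃[ q ] (q < p × ¬ lower x q)

lower<¬lower : ∀ x → lower x p → ¬ lower x q → p < q
lower<¬lower x xp ¬xq =
  ≰⇒> λ q≤p → [ (λ q<p → ¬xq (ℝ.closed x q<p xp)) , (λ { refl → ¬xq xp }) ]′ (split q≤p)
  where
  split : q ≤ p → q < p ⊎ q ≡ p
  split {q} {p} q≤p with q ℚ.<? p
  ... | yes q<p = inj₁ q<p
  ... | no  q≮p = inj₂ (≤-antisym q≤p (≮⇒≥ q≮p))

lower<upper : ∀ x → lower x p → upper x q → p < q
lower<upper x xp (s , s<q , ¬xs) = <-trans (lower<¬lower x xp ¬xs) s<q

upper-inhabited : ∀ x → ∃[ p ] upper x p
upper-inhabited x with ℝ.bounded x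
... | q , ¬xq = q ℚ.+ 1ℚ , q , p<p+1 q , ¬xq

infix 4 _≤ℝ_ _≃ℝ_

_≤ℝ_ : ℝ → ℝ → Set
x ≤ℝ y = ∀ {p} → lower x p → lower y p

_≃ℝ_ : ℝ → ℝ → Set
x ≃ℝ y = x ≤ℝ y × y ≤ℝ x

fromℚ : ℚ → ℝ
fromℚ q = record
  { lower     = _< q
  ; inhabited = q ℚ.- 1ℚ , p-1<p q
  ; bounded   = q , <-irrefl refl
  ; closed    = <-trans
  ; rounded   = λ p<q → let r , p<r , r<q = <-dense p<q in r , p<r , r<q
  }

natℝ : ℕ → ℝ
natℝ n = fromℚ (+ n / 1)

0ℝ 1ℝ : ℝ
0ℝ = natℝ 0
1ℝ = natℝ 1

infix  8 -ℝ_
infixl 7 _*ℝ_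
infixl 6 _+ℝ_ _-ℝ_

_+ℝ_ : ℝ → ℝ → ℝ
x +ℝ y = record
  { lower     = λ p → ∃[ a ] ∃[ b ] (lower x a × lower y b × p < a ℚ.+ b)
  ; inhabited = let a , xa = ℝ.inhabited x
                    b , yb = ℝ.inhabited y
                in a ℚ.+ b ℚ.- 1ℚ , a , b , xa , yb , p-1<p _
  ; bounded   = let u , ¬xu = ℝ.bounded x
                    v , ¬yv = ℝ.bounded y
                in u ℚ.+ v , λ { (a , b , xa , yb , lt) →
                     <-asym lt (+-mono-< (lower<¬lower x xa ¬xu) (lower<¬lower y yb ¬yv)) }
  ; closed    = λ { p<q (a , b , xa , yb , lt) → a , b , xa , yb , <-trans p<q lt }
  ; rounded   = λ { (a , b , xa , yb , lt) →
                    let r , p<r , r<ab = <-dense lt in r , p<r , a , b , xa , yb , r<ab }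
  }

-ℝ_ : ℝ → ℝ
-ℝ x = record
  { lower     = λ p → ∃[ q ] (p < q × ¬ lower x (ℚ.- q))
  ; inhabited = let u , ¬xu = ℝ.bounded x
                in ℚ.- u ℚ.- 1ℚ , ℚ.- u , p-1<p _ , subst (¬_ ∘ lower x) (sym (neg-neg u)) ¬xu
  ; bounded   = let l , xl = ℝ.inhabited x
                in ℚ.- l , λ { (q , -l<q , ¬x-q) →
                     ¬x-q (ℝ.closed x (subst (ℚ.- q <_) (neg-neg l) (neg-antimono-< -l<q)) xl) }
  ; closed    = λ { p<q (r , q<r , ¬x-r) → r , <-trans p<q q<r , ¬x-r }
  ; rounded   = λ { (q , p<q , ¬x-q) →
                    let r , p<r , r<q = <-dense p<q in r , p<r , q , r<q , ¬x-q }
  }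
  where
  neg-neg : ∀ p → ℚ.- (ℚ.- p) ≡ p
  neg-neg p = neg-involutive p
    where open import Algebra.Properties.Group ℚ.+-0-group renaming (⁻¹-involutive to neg-involutive)

_-ℝ_ : ℝ → ℝ → ℝ
x -ℝ y = x +ℝ (-ℝ y)

-- p < x · y, for reals of any sign: x and y lie in rational intervals (a , b)
-- and (c , d) whose products of endpoints all exceed p.
record _<_·_ (p : ℚ) (x y : ℝ) : Set where
  constructor box
  field
    {a b c d} : ℚ
    a<x  : lower x a
    x<b  : upper x b
    c<y  : lower y c
    y<d  : upper y d
    p<ac : p < a * c
    p<ad : p < a * d
    p<bc : p < b * c
    p<bd : p < b * d

_*ℝ_ : ℝ → ℝ → ℝ
x *ℝ y = record
  { lower     = λ p → p < x · y
  ; inhabited =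
      let a , xa = ℝ.inhabited x
          b , xb = upper-inhabited x
          c , yc = ℝ.inhabited y
          d , yd = upper-inhabited y
          m , m≤ac , m≤ad , m≤bc , m≤bd , _ = min₄ (a * c) (a * d) (b * c) (b * d)
          m-1<m = p-1<p m
      in m ℚ.- 1ℚ , box xa xb yc yd (<-≤-trans m-1<m m≤ac) (<-≤-trans m-1<m m≤ad)
                                    (<-≤-trans m-1<m m≤bc) (<-≤-trans m-1<m m≤bd)
  ; bounded   = M₀ , M≮xy
  ; closed    = λ { p<q (box xa xb yc yd q<ac q<ad q<bc q<bd) →
                    box xa xb yc yd (<-trans p<q q<ac) (<-trans p<q q<ad)
                                    (<-trans p<q q<bc) (<-trans p<q q<bd) }
  ; rounded   = λ { (box {a} {b} {c} {d} xa xb yc yd p<ac p<ad p<bc p<bd) →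
      let m , m≤ac , m≤ad , m≤bc , m≤bd , glb = min₄ (a * c) (a * d) (b * c) (b * d)
          r , p<r , r<m = <-dense (glb p<ac p<ad p<bc p<bd)
      in r , p<r , box xa xb yc yd (<-≤-trans r<m m≤ac) (<-≤-trans r<m m≤ad)
                                   (<-≤-trans r<m m≤bc) (<-≤-trans r<m m≤bd) }
  }
  where
  a₀ = proj₁ (ℝ.inhabited x)
  b₀ = proj₁ (upper-inhabited x)
  c₀ = proj₁ (ℝ.inhabited y)
  d₀ = proj₁ (upper-inhabited y)
  xa₀ = proj₂ (ℝ.inhabited x)
  xb₀ = proj₂ (upper-inhabited x)
  yc₀ = proj₂ (ℝ.inhabited y)
  yd₀ = proj₂ (upper-inhabited y)
  M = max₄ (c₀ * a₀) (d₀ * a₀) (c₀ * b₀) (d₀ * b₀)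
  M₀ = proj₁ M
  ca≤M = proj₁ (proj₂ M)
  da≤M = proj₁ (proj₂ (proj₂ M))
  cb≤M = proj₁ (proj₂ (proj₂ (proj₂ M)))
  db≤M = proj₂ (proj₂ (proj₂ (proj₂ M)))

  M≮xy : ¬ (M₀ < x · y)
  M≮xy (box {a} {b} {c} {d} xa xb yc yd M<ac M<ad M<bc M<bd) =
    <-irrefl refl (<-≤-trans M<st st≤M)
    where
    s t′ : ℚ
    s  = a ℚ.⊔ a₀
    t′ = c ℚ.⊔ c₀
    s≤b : s ≤ b
    s≤b = ⊔-lub-≤ (<⇒≤ (lower<upper x xa xb)) (<⇒≤ (lower<upper x xa₀ xb))
    s≤b₀ : s ≤ b₀
    s≤b₀ = ⊔-lub-≤ (<⇒≤ (lower<upper x xa xb₀)) (<⇒≤ (lower<upper x xa₀ xb₀))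
    t≤d : t′ ≤ d
    t≤d = ⊔-lub-≤ (<⇒≤ (lower<upper y yc yd)) (<⇒≤ (lower<upper y yc₀ yd))
    t≤d₀ : t′ ≤ d₀
    t≤d₀ = ⊔-lub-≤ (<⇒≤ (lower<upper y yc yd₀)) (<⇒≤ (lower<upper y yc₀ yd₀))

    M<z*t : ∀ z → M₀ < z * c → M₀ < z * d → M₀ < z * t′
    M<z*t z M<zc M<zd = subst (M₀ <_) (*-comm t′ z)
      ([ <-≤-trans (subst (M₀ <_) (*-comm z c) M<zc)
       , <-≤-trans (subst (M₀ <_) (*-comm z d) M<zd) ]′ (endpoint≤ z (p≤p⊔q c c₀) t≤d))
    M<st : M₀ < s * t′
    M<st = [ <-≤-trans (M<z*t a M<ac M<ad) , <-≤-trans (M<z*t b M<bc M<bd) ]′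
             (endpoint≤ t′ (p≤p⊔q a a₀) s≤b)

    z*t≤M : ∀ z → c₀ * z ≤ M₀ → d₀ * z ≤ M₀ → z * t′ ≤ M₀
    z*t≤M z cz≤M dz≤M = subst (_≤ M₀) (*-comm t′ z)
      ([ (λ le → ≤-trans le cz≤M) , (λ le → ≤-trans le dz≤M) ]′
        (≤endpoint z (p≤q⊔p c c₀) t≤d₀))
    st≤M : s * t′ ≤ M₀
    st≤M = [ (λ le → ≤-trans le (z*t≤M a₀ ca≤M da≤M))
           , (λ le → ≤-trans le (z*t≤M b₀ cb≤M db≤M)) ]′
             (≤endpoint t′ (p≤q⊔p a a₀) s≤b₀)

infixr 8 _^ℝ_

-- b ^ x = sup { s | s ≤ bᵖ for some rational p < x }, for a natural base b ≥ 1,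
-- where s ≤ bᵖ is stated as s^(denominator of p) ≤ b^(numerator of p).
_^ℝ_ : (b : ℕ) → .{{_ : ℕ.NonZero b}} → ℝ → ℝ
b ^ℝ x = record
  { lower     = λ r → ∃[ s ] ∃[ p ] (r < s × 0ℚ ≤ s × lower x p × s ^ (↧ₙ p) ≤ b ^ℤ (↥ p))
  ; inhabited = let p , xp = ℝ.inhabited x
                in 0ℚ ℚ.- 1ℚ , 0ℚ , p , p-1<p 0ℚ , ≤-refl , xp , 0^≤ p
  ; bounded   = let u , ¬xu = ℝ.bounded x
                    n , u≤n = archimedean u
                in fromℕ b ^ n , λ { (s , p , bⁿ<s , 0≤s , xp , sᵈ≤bᵃ) →
                     <-irrefl refl (<-≤-trans
                       (^-monoˡ-< (↧ₙ p) (^-nonNeg n (≤-trans 0≤1 (1≤fromℕ b))) bⁿ<s)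
                       (≤-trans sᵈ≤bᵃ (≤-trans
                         (^ℤ≤^ b (↥≤ p n (≤-trans (<⇒≤ (lower<¬lower x xp ¬xu)) u≤n)))
                         (≤-reflexive (sym (^-assocʳ (fromℕ b) n (↧ₙ p))))))) }
  ; closed    = λ { p<q (s , r , q<s , rest) → s , r , <-trans p<q q<s , rest }
  ; rounded   = λ { (s , p , r<s , rest) →
                    let t , r<t , t<s = <-dense r<s in t , r<t , s , p , t<s , rest }
  }
  where
  0^≤ : ∀ p → 0ℚ ^ (↧ₙ p) ≤ b ^ℤ (↥ p)
  0^≤ p@(ℚ.mkℚ _ d _) = ≤-trans (≤-reflexive (*-zeroˡ (0ℚ ^ d))) (0≤^ℤ b (↥ p))

-- log b x = sup { p | bᵖ ≤ x }, for a natural base b ≥ 2 and a rational x > 0,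
-- where bᵖ ≤ x is stated as b^(numerator of p) ≤ x^(denominator of p).
logℝ : (b : ℕ) → .{{_ : NonTrivial b}} → (x : ℚ) → .{{_ : Positive x}} → ℝ
logℝ b@(suc (suc _)) x = record
  { lower     = λ p → ∃[ q ] (p < q × b ^ℤ (↥ q) ≤ x ^ (↧ₙ q))
  ; inhabited = let n , le = b⁻ⁿ≤x
                in fromℤ (ℤ.- + n) ℚ.- 1ℚ , fromℤ (ℤ.- + n) , p-1<p _ , le
  ; bounded   = let n , x≤n = archimedean x
                in fromℕ n , λ { (q , n<q , bᵃ≤xᵈ) →
                     <-irrefl refl (<-≤-trans (bound n q (<↥ q n n<q)) (≤-trans bᵃ≤xᵈ
                       (≤-trans (^-monoˡ-≤ (↧ₙ q) (<⇒≤ (positive⁻¹ x)) (≤-trans x≤n (n≤b^n b n)))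
                         (≤-reflexive (^-assocʳ (fromℕ b) n (↧ₙ q)))))) }
  ; closed    = λ { p<q (r , q<r , le) → r , <-trans p<q q<r , le }
  ; rounded   = λ { (q , p<q , le) →
                    let r , p<r , r<q = <-dense p<q in r , p<r , q , r<q , le }
  }
  where
  fromℤ : ℤ → ℚ
  fromℤ i = ℚ.mkℚ i 0 (coprime i)
    where
    open import Data.Nat.Coprimality using (Coprime; 1-coprimeTo) renaming (sym to coprime-sym)
    coprime : ∀ i → Coprime ℤ.∣ i ∣ 1
    coprime i = coprime-sym (1-coprimeTo ℤ.∣ i ∣)

  bound : ∀ n q → + (n ℕ.* ↧ₙ q) ℤ.< ↥ q → fromℕ b ^ (n ℕ.* ↧ₙ q) < b ^ℤ (↥ q)
  bound n q lt with ↥ q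
  bound n q (ℤ.+<+ lt) | + m =
    <-≤-trans (^-sucʳ-< (n ℕ.* ↧ₙ q) (1<fromℕ b)) (^-monoʳ-≤ (1≤fromℕ b) lt)

  b⁻ⁿ≤x : ∃[ n ] (b ^ℤ (↥ fromℤ (ℤ.- + n)) ≤ x ^ 1)
  b⁻ⁿ≤x = n , subst₂ _≤_ (eq n) (sym (*-identityʳ x)) le
    where
    instance
      x≢0 : ℚ.NonZero x
      x≢0 = pos⇒nonZero x
    n = proj₁ (archimedean (ℚ.1/ x))
    β = (+ 1 / b) ^ n
    0≤β : 0ℚ ≤ β
    0≤β = ^-nonNeg n (0≤1/ b)
    1≤bⁿx : 1ℚ ≤ fromℕ b ^ n * x
    1≤bⁿx = subst (_≤ fromℕ b ^ n * x) (*-inverseˡ x)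
      (*-monoʳ-≤-nonNeg x {{pos⇒nonNeg x}} (≤-trans (proj₂ (archimedean (ℚ.1/ x))) (n≤b^n b n)))
    le : β ≤ x
    le = subst₂ _≤_ (*-identityʳ β)
      (trans (sym (*-assoc β (fromℕ b ^ n) x)) (trans (cong (_* x) (1/^*^ b n)) (*-identityˡ x)))
      (*-monoˡ-≤-nonNeg β {{ℚ.nonNegative 0≤β}} 1≤bⁿx)
    eq : ∀ n → (+ 1 / b) ^ n ≡ b ^ℤ (ℤ.- + n)
    eq zero    = refl
    eq (suc n) = refl

record RandomVariable (A : Set) : Set where
  field
    size     : ℕ
    weight   : Fin size → ℚ
    weight≥0 : ∀ ω → 0ℚ ≤ weight ω
    total    : sum weight ≡ 1ℚ
    value    : Fin size → A

mapRV : ∀ {A B : Set} → (A → B) → RandomVariable A → RandomVariable B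
mapRV f R = record { RandomVariable R ; value = f ∘ RandomVariable.value R }

Pr : ∀ {A : Set} → DecidableEquality A → RandomVariable A → A → ℚ
Pr _≟_ R w = sum λ ω → if does (value ω ≟ w) then weight ω else 0ℚ
  where open RandomVariable R

record FiniteSubset (A : Set) : Set where
  field
    elements : List A
    unique   : Unique elements

∣_∣ : ∀ {A} → FiniteSubset A → ℕ
∣ S ∣ = List.length (FiniteSubset.elements S)

infix 4 _∈ˢ_
_∈ˢ_ : ∀ {A} → A → FiniteSubset A → Set
a ∈ˢ S = a ∈ FiniteSubset.elements S

uniform : ∀ {A} (S : FiniteSubset A) → .{{_ : ℕ.NonZero ∣ S ∣}} → RandomVariable A
uniform S = record
  { size     = ∣ S ∣
  ; weight   = λ _ → + 1 / ∣ S ∣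
  ; weight≥0 = λ _ → 0≤1/ ∣ S ∣
  ; total    = trans (sum-const ∣ S ∣ (+ 1 / ∣ S ∣)) (n*1/n ∣ S ∣)
  ; value    = List.lookup (FiniteSubset.elements S)
  }
  where
  sum-const : ∀ n x → sum {n} (λ _ → x) ≡ fromℕ n * x
  sum-const zero    x = sym (*-zeroˡ x)
  sum-const (suc n) x = begin
    x ℚ.+ sum {n} (λ _ → x)    ≡⟨ cong₂ ℚ._+_ (sym (*-identityˡ x)) (sum-const n x) ⟩
    1ℚ * x ℚ.+ fromℕ n * x     ≡⟨ sym (*-distribʳ-+ x 1ℚ (fromℕ n)) ⟩
    (1ℚ ℚ.+ fromℕ n) * x       ≡⟨ cong (_* x) (sym (fromℕ-suc n)) ⟩
    fromℕ (suc n) * x          ∎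
    where open ≡-Reasoning

sum-nonNeg : ∀ {n} (f : Fin n → ℚ) → (∀ i → 0ℚ ≤ f i) → 0ℚ ≤ sum f
sum-nonNeg {zero}  f f≥0 = ≤-refl
sum-nonNeg {suc n} f f≥0 = +-mono-≤ (f≥0 zero) (sum-nonNeg (f ∘ suc) (f≥0 ∘ suc))

term≤sum : ∀ {n} (f : Fin n → ℚ) → (∀ i → 0ℚ ≤ f i) → ∀ i → f i ≤ sum f
term≤sum f f≥0 zero = subst (_≤ sum f) (+-identityʳ (f zero))
  (+-monoʳ-≤ (f zero) (sum-nonNeg (f ∘ suc) (f≥0 ∘ suc)))
term≤sum f f≥0 (suc i) = subst (_≤ sum f) (+-identityˡ (f (suc i)))
  (+-mono-≤ (f≥0 zero) (term≤sum (f ∘ suc) (f≥0 ∘ suc) i))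

positive-term : ∀ {n} (f : Fin n → ℚ) → (∀ i → 0ℚ ≤ f i) → 0ℚ < sum f → ∃[ i ] 0ℚ < f i
positive-term {zero}  f f≥0 0<0 = ⊥-elim (<-irrefl refl 0<0)
positive-term {suc n} f f≥0 0<sum with 0ℚ ℚ.<? f zero
... | yes 0<f₀ = zero , 0<f₀
... | no  0≮f₀ =
  let i , 0<fᵢ = positive-term (f ∘ suc) (f≥0 ∘ suc)
        (<-≤-trans 0<sum (subst (sum f ≤_) (+-identityˡ _) (+-monoˡ-≤ _ (≮⇒≥ 0≮f₀))))
  in suc i , 0<fᵢ

IsPrimePower : ℕ → Set
IsPrimePower q = ∃[ p ] ∃[ e ] (Prime p × 1 ℕ.≤ e × q ≡ p ℕ.^ e)

record FiniteField (q : ℕ) : Set₁ where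
  infixl 7 _·_
  infixl 6 _⊕_
  infix  8 ⊖_
  field
    Carrier : Set
    _⊕_ _·_ : Carrier → Carrier → Carrier
    ⊖_      : Carrier → Carrier
    0# 1#   : Carrier
    isCommutativeRing : IsCommutativeRing _≡_ _⊕_ _·_ ⊖_ 0# 1#
    0≢1     : 0# ≢ 1#
    inverse : ∀ x → x ≢ 0# → ∃[ y ] x · y ≡ 1#
    enumeration : Carrier ↔ Fin q

module _ {q : ℕ} (F : FiniteField q) where
  open FiniteField F

  to = Inverse.to enumeration
  from = Inverse.from enumeration

  from-to : ∀ x → from (to x) ≡ x
  from-to = Inverse.strictlyInverseʳ enumeration

  _≟_ : DecidableEquality Carrier
  x ≟ y with to x Fin.≟ to y
  ... | yes eq = yes (trans (sym (from-to x)) (trans (cong from eq) (from-to y)))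
  ... | no neq = no (neq ∘ cong to)

  scalars : List Carrier
  scalars = List.map from (List.allFin q)

  ∈-scalars : ∀ x → x ∈ scalars
  ∈-scalars x = subst (_∈ scalars) (from-to x) (∈.∈-map⁺ from (∈.∈-allFin (to x)))

  order-nonTrivial : NonTrivial q
  order-nonTrivial = go q to (λ {x} {y} eq → trans (sym (from-to x)) (trans (cong from eq) (from-to y)))
    where
    go : ∀ n (f : Carrier → Fin n) → (∀ {x y} → f x ≡ f y → x ≡ y) → NonTrivial n
    go zero f inj with () ← f 0#
    go (suc zero) f inj = ⊥-elim (0≢1 (inj (fin1 (f 0#) (f 1#))))
      where
      fin1 : (i j : Fin 1) → i ≡ j
      fin1 zero zero = refl
    go (suc (suc n)) f inj = _

module FurstenbergSets {q : ℕ} (F : FiniteField q) where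
  open FiniteField F using (Carrier; _⊕_; _·_; ⊖_; 0#; 1#)

  instance
    q-nonTrivial : NonTrivial q
    q-nonTrivial = order-nonTrivial F

    q-nonZero : ℕ.NonZero q
    q-nonZero = ℕ.nonTrivial⇒nonZero q

  𝔽^ : ℕ → Set
  𝔽^ n = Vec Carrier n

  infixl 6 _+ᵛ_
  infixr 7 _*ᵛ_

  0ᵛ : ∀ {n} → 𝔽^ n
  0ᵛ = Vec.replicate _ 0#

  _+ᵛ_ : ∀ {n} → 𝔽^ n → 𝔽^ n → 𝔽^ n
  _+ᵛ_ = Vec.zipWith _⊕_

  _*ᵛ_ : ∀ {n} → Carrier → 𝔽^ n → 𝔽^ n
  c *ᵛ v = Vec.map (c ·_) v

  vectorSpace : ℕ → RawLeftModule Carrier 0ℓ 0ℓ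
  vectorSpace n = record
    { Carrierᴹ = 𝔽^ n
    ; _≈ᴹ_     = _≡_
    ; _+ᴹ_     = _+ᵛ_
    ; _*ₗ_     = _*ᵛ_
    ; 0ᴹ       = 0ᵛ
    ; -ᴹ_      = Vec.map ⊖_
    }

  IsLinear : ∀ {m n} → (𝔽^ m → 𝔽^ n) → Set
  IsLinear {m} {n} =
    Morphism.LeftModuleMorphisms.IsLeftModuleHomomorphism (vectorSpace m) (vectorSpace n)

  IsOnto : ∀ {m n} → (𝔽^ m → 𝔽^ n) → Set
  IsOnto = Surjective _≡_ _≡_

  _≟ᵛ_ : ∀ {n} → DecidableEquality (𝔽^ n)
  _≟ᵛ_ = Vec.≡-dec (_≟_ F)

  vectors : ∀ n → List (𝔽^ n)
  vectors zero    = [] ∷ []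
  vectors (suc n) = List.cartesianProductWith _∷_ (scalars F) (vectors n)

  ∈-vectors : ∀ {n} (v : 𝔽^ n) → v ∈ vectors n
  ∈-vectors []      = here refl
  ∈-vectors (x ∷ v) = ∈.∈-cartesianProductWith⁺ _∷_ (∈-scalars F x) (∈-vectors v)

  record IsSubspace {n} (W : Pred (𝔽^ n) 0ℓ) : Set where
    field
      0-closed : W 0ᵛ
      +-closed : ∀ {u v} → W u → W v → W (u +ᵛ v)
      *-closed : ∀ c {v} → W v → W (c *ᵛ v)

  linearCombination : ∀ {n k} → Vec Carrier k → Vec (𝔽^ n) k → 𝔽^ n
  linearCombination cs vs = Vec.foldr′ _+ᵛ_ 0ᵛ (Vec.zipWith _*ᵛ_ cs vs)

  record IsBasis {n k} (W : Pred (𝔽^ n) 0ℓ) (vs : Vec (𝔽^ n) k) : Set where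
    field
      members     : All W vs
      spanning    : ∀ {v} → W v → ∃[ cs ] v ≡ linearCombination cs vs
      independent : ∀ cs → linearCombination cs vs ≡ 0ᵛ → cs ≡ 0ᵛ

  HasDimension : ∀ {n} → Pred (𝔽^ n) 0ℓ → ℕ → Set
  HasDimension {n} W k = ∃[ vs ] IsBasis {n} {k} W vs

  translate : ∀ {n} → 𝔽^ n → Pred (𝔽^ n) 0ℓ → Pred (𝔽^ n) 0ℓ
  translate a W v = ∃[ w ] (W w × v ≡ a +ᵛ w)

  AtLeast : ∀ {n} → ℕ → Pred (𝔽^ n) 0ℓ → Set
  AtLeast {n} m P = Σ (Fin m ↣ 𝔽^ n) λ f → ∀ i → P (Injection.to f i)

  IsFurstenberg : ∀ {n} → ℕ → ℕ → FiniteSubset (𝔽^ n) → Set₁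
  IsFurstenberg {n} k m S =
    (W : Pred (𝔽^ n) 0ℓ) → IsSubspace W → HasDimension W k →
    ∃[ a ] AtLeast m (λ v → translate a W v × v ∈ˢ S)

  maxPr : ∀ {n} → RandomVariable (𝔽^ n) → ℚ
  maxPr {n} R = max 0ℚ (List.map (Pr _≟ᵛ_ R) (vectors n))

  maxPr-positive : ∀ {n} (R : RandomVariable (𝔽^ n)) → Positive (maxPr R)
  maxPr-positive {n} R = ℚ.positive (<-≤-trans 0<wω (≤-trans wω≤Pr Pr≤max))
    where
    open RandomVariable R
    ∃ω = positive-term weight weight≥0 (subst (0ℚ <_) (sym total) (positive⁻¹ 1ℚ))
    ω = proj₁ ∃ω
    0<wω = proj₂ ∃ω
    term : Fin size → ℚ
    term i = if does (value i ≟ᵛ value ω) then weight i else 0ℚ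
    term≥0 : ∀ i → 0ℚ ≤ term i
    term≥0 i with value i ≟ᵛ value ω
    ... | yes _ = weight≥0 i
    ... | no  _ = ≤-refl
    termω : term ω ≡ weight ω
    termω with value ω ≟ᵛ value ω
    ... | yes _  = refl
    ... | no neq = ⊥-elim (neq refl)
    wω≤Pr : weight ω ≤ Pr _≟ᵛ_ R (value ω)
    wω≤Pr = subst (_≤ sum term) termω (term≤sum term term≥0 ω)
    Pr≤max : Pr _≟ᵛ_ R (value ω) ≤ maxPr R
    Pr≤max = v≤max⁺ 0ℚ _ (inj₂
      (Any.map ≤-reflexive (∈.∈-map⁺ (Pr _≟ᵛ_ R) (∈-vectors (value ω)))))

  H∞ : ∀ {n} → RandomVariable (𝔽^ n) → ℝ
  H∞ R = -ℝ logℝ q (maxPr R) {{maxPr-positive R}}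

  StatementA : (n k : ℕ) → .{{_ : ℕ.NonZero k}} → ℝ → Set₁
  StatementA n k C =
    (m : ℕ) → .{{_ : ℕ.NonZero m}} → (S : FiniteSubset (𝔽^ n)) → IsFurstenberg k m S →
    C *ℝ m ^ℝ fromℚ (+ n / k) ≤ℝ natℝ ∣ S ∣

  -- Non-emptiness of S is implied by ∣ S ∣ ≃ q ^ (δ n); it is what makes the
  -- uniform distribution well defined.
  StatementB : (n k : ℕ) → ℝ → Set₁
  StatementB n k D =
    (δ : ℝ) → 0ℝ ≤ℝ δ → δ ≤ℝ 1ℝ →
    (S : FiniteSubset (𝔽^ n)) → .{{_ : ℕ.NonZero ∣ S ∣}} →
    natℝ ∣ S ∣ ≃ℝ q ^ℝ (δ *ℝ natℝ n) →
    Σ (𝔽^ n → 𝔽^ (n ℕ.∸ k)) λ φ → IsLinear φ × IsOnto φ ×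
      δ *ℝ natℝ (n ℕ.∸ k) -ℝ D ≤ℝ H∞ (mapRV φ (uniform S))

{-# OPTIONS --safe #-}
module Submission where

-- Let S be a (k,m)-Furstenberg set with s elements, s ≥ 1, and let δ = log_q s / n.
-- Then s = q^(δn) and 0 ≤ δ ≤ 1, so B(n,k) gives an onto linear map φ such that
-- H∞(φ(U_S)) ≥ δ(n-k) - D. The kernel of φ has dimension k, so some translate of
-- it meets S in at least m points. All of these points lie in one fibre of φ, which
-- therefore has probability at least m/s. Hence δ(n-k) - D ≤ log_q s - log_q m, that
-- is log_q m ≤ δk + D, and raising m ≤ q^D s^(k/n) to the power n/k gives the bound.
--
-- A real is here a lower cut of rationals, so the last inequality is proved for
-- rational approximations of the exponents. Its central relation is x ≤[ b ]^ r,
-- meaning x ≤ b^r for rational x and r, which is stable under products and powers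
-- (≤^-* and ≤^-^). Suppose that t ≤ q^r with r < -(n/k) D, that t′ ≤ m^(n/k), and put
-- c = n - k. The lemma log-gap approximates log_q s closely enough, from below by G and
-- from above by H, for B(n,k) to give m/s ≤ q^(-p) with p n = r k + H c. The three
-- bounds t ≤ q^r, m/s ≤ q^(-p) and s ≤ q^H then combine to t^k (m/s)^n s^c ≤ q^0 = 1,
-- which is (t t′)^k ≤ s^k (exponent-count). Every rational below q^(-(n/k) D) m^(n/k)
-- is below such a product t t′ (^ℝ*^ℝ⁻), and entropy⇒size follows.
--
-- The identity q^(log_q s) = s (^ℝ-logℝ) holds because log_q s can be approximated
-- to any precision (approx-log), while a number below 1 is at most q^(-ε) for some
-- ε > 0 (<1⇒≤^negative), by Bernoulli's inequality.
--
-- The kernel is handled by parametrizations, that is injective linear maps from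
-- 𝔽^k onto a subspace. The kernel of an onto map to 𝔽^(r+1) is the kernel of a
-- nonzero functional on the kernel of its last r coordinates, so its dimension
-- follows by induction on r (kernel-parametrization).

open import Defs
open import Data.Rational as ℚ using (ℚ; 0ℚ; 1ℚ; _/_; ↥_; ↧ₙ_; _+_; _*_; -_; Positive)
import Data.Rational.Properties as ℚ
open import Relation.Binary.Bundles using (DecTotalOrder)
open import Algebra.Bundles using (CommutativeRing)
import Algebra.Module.Morphism.Structures as Morphism
open import Algebra.Properties.CommutativeMonoid.Sum
  (CommutativeRing.+-commutativeMonoid ℚ.+-*-commutativeRing) using (sum; sum-remove)
open import Algebra.Properties.CommutativeSemigroup
  (CommutativeRing.*-commutativeSemigroup ℚ.+-*-commutativeRing) using (interchange)
open import Algebra.Properties.CommutativeSemiring.Exp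
  (CommutativeRing.commutativeSemiring ℚ.+-*-commutativeRing)
  using (_^_; ^-assocʳ; ^-homo-*; ^-distrib-*)
open import Algebra.Structures using (IsCommutativeRing)
open import Data.Bool.Base using (if_then_else_)
open import Data.Empty using (⊥; ⊥-elim)
open import Data.Fin.Base using (Fin; zero; suc; punchIn; punchOut)
import Data.Fin.Properties as Fin
open import Data.Integer as ℤ using (ℤ; +_; -[1+_])
import Data.Integer.Properties as ℤ
import Data.Integer.Solver as ℤ-Solver
open import Data.List.Base as List using (List; []; _∷_; length)
open import Data.List.Extrema (DecTotalOrder.totalOrder ℚ.≤-decTotalOrder) using (v≤max⁺)
open import Data.List.Membership.Propositional using (_∈_)
import Data.List.Membership.Propositional.Properties as ∈
import Data.List.Membership.Setoid.Properties as ∈ˢ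
import Data.List.Properties as List
import Data.List.Relation.Unary.All as ListAll
open import Data.List.Relation.Unary.AllPairs using ([]; _∷_)
open import Data.List.Relation.Unary.Any as Any using (here; there; index)
open import Data.List.Relation.Unary.Any.Properties using (lookup-index)
open import Data.List.Relation.Unary.Unique.Propositional using (Unique)
open import Data.Nat as ℕ using (ℕ; zero; suc; NonZero; NonTrivial; _<_)
import Data.Nat.Properties as ℕ
open import Data.Product using (Σ; ∃-syntax; _×_; _,_; proj₁; proj₂)
open import Data.Rational.Solver using (module +-*-Solver)
import Data.Rational.Unnormalised as ℚᵘ
import Data.Rational.Unnormalised.Properties as ℚᵘ
open import Data.Sum.Base using ([_,_]′; inj₂)
open import Data.Vec.Base as Vec using (Vec; []; _∷_; head; tail)
import Data.Vec.Properties as Vec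
open import Data.Vec.Relation.Unary.All using (All; []; _∷_)
open import Function.Base using (_∘_; id)
open import Function.Bundles using (Injection)
open import Function.Definitions using (Injective)
open import Level using (0ℓ)
open import Relation.Binary.PropositionalEquality
open import Relation.Nullary using (¬_; yes; no; does)
open import Relation.Unary using (Pred)

-- Rational arithmetic

*-mono-≤ : ∀ {x y z w} → 0ℚ ℚ.≤ x → x ℚ.≤ y → 0ℚ ℚ.≤ z → z ℚ.≤ w → x * z ℚ.≤ y * w
*-mono-≤ {x} {y} {z} {w} 0≤x x≤y 0≤z z≤w = ℚ.≤-trans
  (ℚ.*-monoʳ-≤-nonNeg z {{ℚ.nonNegative 0≤z}} x≤y)
  (ℚ.*-monoˡ-≤-nonNeg y {{ℚ.nonNegative (ℚ.≤-trans 0≤x x≤y)}} z≤w)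

*-nonNeg : ∀ {x y} → 0ℚ ℚ.≤ x → 0ℚ ℚ.≤ y → 0ℚ ℚ.≤ x * y
*-nonNeg {x} {y} 0≤x 0≤y = ℚ.≤-trans (ℚ.≤-reflexive (sym (ℚ.*-zeroˡ y)))
  (ℚ.*-monoʳ-≤-nonNeg y {{ℚ.nonNegative 0≤y}} 0≤x)

0≤fromℕ : ∀ n → 0ℚ ℚ.≤ fromℕ n
0≤fromℕ n = fromℕ-mono {0} {n} ℕ.z≤n

^-cancelˡ-≤ : ∀ n .{{_ : NonZero n}} {x y} → 0ℚ ℚ.≤ y → x ^ n ℚ.≤ y ^ n → x ℚ.≤ y
^-cancelˡ-≤ n 0≤y xⁿ≤yⁿ = ℚ.≮⇒≥ λ y<x →
  ℚ.<-irrefl refl (ℚ.<-≤-trans (^-monoˡ-< n 0≤y y<x) xⁿ≤yⁿ)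

^-swap : ∀ x m n → (x ^ m) ^ n ≡ (x ^ n) ^ m
^-swap x m n = trans (^-assocʳ x m n) (trans (cong (x ^_) (ℕ.*-comm m n)) (sym (^-assocʳ x n m)))

0<fromℕ : ∀ n .{{_ : NonZero n}} → 0ℚ ℚ.< fromℕ n
0<fromℕ n = ℚ.<-≤-trans (ℚ.positive⁻¹ 1ℚ) (1≤fromℕ n)

*-monoˡ-< : ∀ {x y z} → 0ℚ ℚ.< z → x ℚ.< y → x * z ℚ.< y * z
*-monoˡ-< {z = z} 0<z = ℚ.*-monoˡ-<-pos z {{ℚ.positive 0<z}}

neg-neg : ∀ x → - (- x) ≡ x
neg-neg = solve 1 (λ x → (:- (:- x)) := x) refl
  where open +-*-Solver using (solve; :-_; _:=_)

1/-pos : ∀ N .{{_ : NonZero N}} → 0ℚ ℚ.< + 1 / N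
1/-pos N = ℚ.positive⁻¹ (+ 1 / N) {{ℚ.normalize-pos 1 N}}

archimedean⁺ : ∀ {h} y → 0ℚ ℚ.< h → ∃[ N ] NonZero N × y ℚ.≤ fromℕ N * h
archimedean⁺ {h} y 0<h = suc N , _ , (begin
  y                    ≡⟨ sym (ℚ.*-identityʳ y) ⟩
  y * 1ℚ               ≡⟨ cong (y *_) (sym (ℚ.*-inverseˡ h)) ⟩
  y * (h⁻¹ * h)        ≡⟨ sym (ℚ.*-assoc y h⁻¹ h) ⟩
  y * h⁻¹ * h          ≤⟨ ℚ.*-monoʳ-≤-nonNeg h {{ℚ.nonNegative (ℚ.<⇒≤ 0<h)}} y/h≤ ⟩
  fromℕ (suc N) * h    ∎)
  where
  open ℚ.≤-Reasoning
  instance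
    h≢0 : ℚ.NonZero h
    h≢0 = ℚ.>-nonZero 0<h
  h⁻¹ = ℚ.1/ h
  N = proj₁ (archimedean (y * h⁻¹))
  y/h≤ : y * h⁻¹ ℚ.≤ fromℕ (suc N)
  y/h≤ = ℚ.≤-trans (proj₂ (archimedean (y * h⁻¹))) (fromℕ-mono (ℕ.n≤1+n N))

x*1/n*n≡x : ∀ n .{{_ : NonZero n}} x → x * (+ 1 / n) * fromℕ n ≡ x
x*1/n*n≡x n x = trans (ℚ.*-assoc x (+ 1 / n) (fromℕ n))
  (trans (cong (x *_) (trans (ℚ.*-comm (+ 1 / n) (fromℕ n)) (n*1/n n))) (ℚ.*-identityʳ x))

x*n*1/n≡x : ∀ n .{{_ : NonZero n}} x → x * fromℕ n * (+ 1 / n) ≡ x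
x*n*1/n≡x n x = trans (ℚ.*-assoc x (fromℕ n) (+ 1 / n))
  (trans (cong (x *_) (n*1/n n)) (ℚ.*-identityʳ x))

+-/ : ∀ i j N .{{_ : NonZero N}} → (i ℤ.+ j) / N ≡ i / N + j / N
+-/ i j N@(suc N-1) = ℚ.toℚᵘ-injective (ℚᵘ.≃-trans (ℚ.toℚᵘ-fromℚᵘ (ℚᵘ.mkℚᵘ (i ℤ.+ j) N-1))
  (ℚᵘ.≃-trans (ℚᵘ.*≡* eq) (ℚᵘ.≃-sym (ℚᵘ.≃-trans (ℚ.toℚᵘ-homo-+ (i / N) (j / N))
    (ℚᵘ.+-cong (ℚ.toℚᵘ-fromℚᵘ (ℚᵘ.mkℚᵘ i N-1)) (ℚ.toℚᵘ-fromℚᵘ (ℚᵘ.mkℚᵘ j N-1)))))))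
  where
  open ℤ-Solver.+-*-Solver using (solve; _:+_; _:*_; _:=_)
  eq : (i ℤ.+ j) ℤ.* + (N ℕ.* N) ≡ (i ℤ.* + N ℤ.+ j ℤ.* + N) ℤ.* + N
  eq = trans (cong ((i ℤ.+ j) ℤ.*_) (ℤ.pos-* N N))
    (solve 3 (λ i j N → (i :+ j) :* (N :* N) := (i :* N :+ j :* N) :* N) refl i j (+ N))

1/-≤ : ∀ {ε} N .{{_ : NonZero N}} → 1ℚ ℚ.≤ fromℕ N * ε → + 1 / N ℚ.≤ ε
1/-≤ {ε} N 1≤Nε = ineq (+ 1 / N) (fromℕ N) (0≤1/ N) (n*1/n N) 1≤Nε
  where
  ineq : ∀ y z → 0ℚ ℚ.≤ y → z * y ≡ 1ℚ → 1ℚ ℚ.≤ z * ε → y ℚ.≤ ε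
  ineq y z 0≤y zy≡1 1≤zε = begin
    y              ≡⟨ sym (ℚ.*-identityʳ y) ⟩
    y * 1ℚ         ≤⟨ ℚ.*-monoˡ-≤-nonNeg y {{ℚ.nonNegative 0≤y}} 1≤zε ⟩
    y * (z * ε)    ≡⟨ sym (ℚ.*-assoc y z ε) ⟩
    y * z * ε      ≡⟨ cong (_* ε) (trans (ℚ.*-comm y z) zy≡1) ⟩
    1ℚ * ε         ≡⟨ ℚ.*-identityˡ ε ⟩
    ε              ∎
    where open ℚ.≤-Reasoning

suc-/ : ∀ i N .{{_ : NonZero N}} → + i / N + + 1 / N ≡ + suc i / N
suc-/ i N = trans (sym (+-/ (+ i) (+ 1) N)) (cong (λ j → + j / N) (ℕ.+-comm i 1))

fromℕ-+ : ∀ m n → fromℕ (m ℕ.+ n) ≡ fromℕ m + fromℕ n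
fromℕ-+ m n = +-/ (+ m) (+ n) 1

n/k*k : ∀ n k .{{_ : NonZero k}} → (+ n / k) * fromℕ k ≡ fromℕ n
n/k*k zero    k = trans (cong (_* fromℕ k) 0/k) (ℚ.*-zeroˡ (fromℕ k))
  where
  0/k : + 0 / k ≡ 0ℚ
  0/k = ℚ.0/n≡0 k
n/k*k (suc n) k = begin
  (+ suc n / k) * fromℕ k                          ≡⟨ cong (_* fromℕ k) (sym (suc-/ n k)) ⟩
  (+ n / k + + 1 / k) * fromℕ k                    ≡⟨ ℚ.*-distribʳ-+ (fromℕ k) (+ n / k) (+ 1 / k) ⟩
  (+ n / k) * fromℕ k + (+ 1 / k) * fromℕ k        ≡⟨ cong₂ _+_ (n/k*k n k)
                                                       (trans (ℚ.*-comm (+ 1 / k) (fromℕ k)) (n*1/n k)) ⟩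
  fromℕ n + 1ℚ                                     ≡⟨ ℚ.+-comm (fromℕ n) 1ℚ ⟩
  1ℚ + fromℕ n                                     ≡⟨ sym (fromℕ-suc n) ⟩
  fromℕ (suc n)                                    ∎
  where open ≡-Reasoning

fromℕ-* : ∀ m n → fromℕ (m ℕ.* n) ≡ fromℕ m * fromℕ n
fromℕ-* zero    n = sym (ℚ.*-zeroˡ (fromℕ n))
fromℕ-* (suc m) n = begin
  fromℕ (n ℕ.+ m ℕ.* n)              ≡⟨ fromℕ-+ n (m ℕ.* n) ⟩
  fromℕ n + fromℕ (m ℕ.* n)          ≡⟨ cong₂ _+_ (sym (ℚ.*-identityˡ (fromℕ n))) (fromℕ-* m n) ⟩
  1ℚ * fromℕ n + fromℕ m * fromℕ n   ≡⟨ sym (ℚ.*-distribʳ-+ (fromℕ n) 1ℚ (fromℕ m)) ⟩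
  (1ℚ + fromℕ m) * fromℕ n           ≡⟨ cong (_* fromℕ n) (sym (fromℕ-suc m)) ⟩
  fromℕ (suc m) * fromℕ n            ∎
  where open ≡-Reasoning

fromℕ-^ : ∀ b n → fromℕ (b ℕ.^ n) ≡ fromℕ b ^ n
fromℕ-^ b zero    = refl
fromℕ-^ b (suc n) = trans (fromℕ-* b (b ℕ.^ n)) (cong (fromℕ b *_) (fromℕ-^ b n))

-- The witness is θ = h / M with M larger than both h and y.
small-multiple : ∀ y {h} → 0ℚ ℚ.< h → ∃[ θ ] 0ℚ ℚ.< θ × θ ℚ.< 1ℚ × y * θ ℚ.< h
small-multiple y {h} 0<h = h * M⁻¹ , 0<θ
  , subst (h * M⁻¹ ℚ.<_) (ℚ.*-inverseʳ M) (*-monoˡ-< 0<M⁻¹ h<M)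
  , subst (y * (h * M⁻¹) ℚ.<_) M*θ≡h (*-monoˡ-< 0<θ y<M)
  where
  M = 1ℚ + (h + (y ℚ.⊔ 0ℚ))
  0≤y⊔0 : 0ℚ ℚ.≤ y ℚ.⊔ 0ℚ
  0≤y⊔0 = ℚ.p≤q⊔p y 0ℚ
  h<M : h ℚ.< M
  h<M = subst (ℚ._< M) (trans (ℚ.+-identityˡ (h + 0ℚ)) (ℚ.+-identityʳ h))
    (ℚ.+-mono-<-≤ (ℚ.positive⁻¹ 1ℚ) (ℚ.+-monoʳ-≤ h 0≤y⊔0))
  y<M : y ℚ.< M
  y<M = subst (ℚ._< M) (trans (ℚ.+-identityˡ (0ℚ + y)) (ℚ.+-identityˡ y))
    (ℚ.+-mono-<-≤ (ℚ.positive⁻¹ 1ℚ) (ℚ.+-mono-≤ (ℚ.<⇒≤ 0<h) (ℚ.p≤p⊔q y 0ℚ)))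
  0<M : 0ℚ ℚ.< M
  0<M = ℚ.<-trans 0<h h<M
  instance
    M-pos : Positive M
    M-pos = ℚ.positive 0<M
    M≢0 : ℚ.NonZero M
    M≢0 = ℚ.pos⇒nonZero M
  M⁻¹ = ℚ.1/ M
  0<M⁻¹ : 0ℚ ℚ.< M⁻¹
  0<M⁻¹ = ℚ.positive⁻¹ M⁻¹ {{ℚ.1/pos⇒pos M}}
  0<θ : 0ℚ ℚ.< h * M⁻¹
  0<θ = subst (ℚ._< h * M⁻¹) (ℚ.*-zeroˡ M⁻¹) (*-monoˡ-< 0<M⁻¹ 0<h)
  M*θ≡h : M * (h * M⁻¹) ≡ h
  M*θ≡h = trans (cong (M *_) (ℚ.*-comm h M⁻¹)) (trans (sym (ℚ.*-assoc M M⁻¹ h))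
    (trans (cong (_* h) (ℚ.*-inverseʳ M)) (ℚ.*-identityˡ h)))

bernoulli : ∀ {h} N → 0ℚ ℚ.≤ h → h ℚ.≤ 1ℚ → (1ℚ ℚ.- h) ^ N * (1ℚ + fromℕ N * h) ℚ.≤ 1ℚ
bernoulli {h} zero    0≤h h≤1 = ℚ.≤-reflexive (begin
  1ℚ * (1ℚ + 0ℚ * h)   ≡⟨ ℚ.*-identityˡ _ ⟩
  1ℚ + 0ℚ * h          ≡⟨ cong (λ z → 1ℚ + z) (ℚ.*-zeroˡ h) ⟩
  1ℚ                   ∎)
  where open ≡-Reasoning
bernoulli {h} (suc N) 0≤h h≤1 = begin
  (1-h * 1-h ^ N) * (1ℚ + fromℕ (suc N) * h)        ≡⟨ cong (λ z → (1-h * 1-h ^ N) * (1ℚ + z * h)) (fromℕ-suc N) ⟩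
  (1-h * 1-h ^ N) * (1ℚ + (1ℚ + fromℕ N) * h)       ≡⟨ step h (1-h ^ N) (fromℕ N) ⟩
  1-h ^ N * (1ℚ + fromℕ N * h + - ((1ℚ + fromℕ N) * (h * h)))
    ≤⟨ drop-square ⟩
  1-h ^ N * (1ℚ + fromℕ N * h)                      ≤⟨ bernoulli N 0≤h h≤1 ⟩
  1ℚ                                                ∎
  where
  open ℚ.≤-Reasoning
  open +-*-Solver using (solve; _:+_; _:*_; :-_; _:=_; con)
  1-h = 1ℚ ℚ.- h
  0≤1-h : 0ℚ ℚ.≤ 1-h
  0≤1-h = subst (ℚ._≤ 1-h) (ℚ.+-inverseʳ h) (ℚ.+-monoˡ-≤ (- h) h≤1)
  -- (1 - h)(1 + (n+1) h) = 1 + n h - (n+1) h², where the last term can be dropped.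
  step : ∀ h P n → ((1ℚ ℚ.- h) * P) * (1ℚ + (1ℚ + n) * h) ≡
                   P * (1ℚ + n * h + - ((1ℚ + n) * (h * h)))
  step = solve 3 (λ h P n →
    ((con 1ℚ :+ (:- h)) :* P) :* (con 1ℚ :+ (con 1ℚ :+ n) :* h) :=
    P :* (con 1ℚ :+ n :* h :+ (:- ((con 1ℚ :+ n) :* (h :* h))))) refl
  0≤sq : 0ℚ ℚ.≤ (1ℚ + fromℕ N) * (h * h)
  0≤sq = *-nonNeg (ℚ.+-mono-≤ 0≤1 (0≤fromℕ N)) (*-nonNeg 0≤h 0≤h)
  drop-square = ℚ.*-monoˡ-≤-nonNeg (1-h ^ N) {{ℚ.nonNegative (^-nonNeg N 0≤1-h)}}
    (subst (1ℚ + fromℕ N * h + - ((1ℚ + fromℕ N) * (h * h)) ℚ.≤_) (ℚ.+-identityʳ _)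
      (ℚ.+-monoʳ-≤ (1ℚ + fromℕ N * h) (ℚ.neg-antimono-≤ 0≤sq)))

-- Integer exponents

^ℤ-⊖ : ∀ b .{{_ : NonZero b}} m n → b ^ℤ (m ℤ.⊖ n) ≡ fromℕ b ^ m * (+ 1 / b) ^ n
^ℤ-⊖ b m       zero    = sym (ℚ.*-identityʳ (fromℕ b ^ m))
^ℤ-⊖ b zero    (suc n) = sym (ℚ.*-identityˡ _)
^ℤ-⊖ b (suc m) (suc n) = begin
  b ^ℤ (suc m ℤ.⊖ suc n)                   ≡⟨ cong (b ^ℤ_) (ℤ.[1+m]⊖[1+n]≡m⊖n m n) ⟩
  b ^ℤ (m ℤ.⊖ n)                           ≡⟨ ^ℤ-⊖ b m n ⟩
  β ^ m * α ^ n                            ≡⟨ sym (ℚ.*-identityˡ _) ⟩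
  1ℚ * (β ^ m * α ^ n)                     ≡⟨ cong (_* (β ^ m * α ^ n)) (sym (n*1/n b)) ⟩
  (β * α) * (β ^ m * α ^ n)                ≡⟨ interchange β α (β ^ m) (α ^ n) ⟩
  (β * β ^ m) * (α * α ^ n)                ∎
  where
  open ≡-Reasoning
  α = + 1 / b
  β = fromℕ b

^ℤ-+ : ∀ b .{{_ : NonZero b}} i j → b ^ℤ (i ℤ.+ j) ≡ b ^ℤ i * b ^ℤ j
^ℤ-+ b (+ m)    (+ n)    = ^-homo-* (fromℕ b) m n
^ℤ-+ b (+ m)    -[1+ n ] = ^ℤ-⊖ b m (suc n)
^ℤ-+ b -[1+ m ] (+ n)    = trans (^ℤ-⊖ b n (suc m)) (ℚ.*-comm (fromℕ b ^ n) ((+ 1 / b) ^ suc m))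
^ℤ-+ b -[1+ m ] -[1+ n ] = trans
  (cong ((+ 1 / b) ^_) (cong suc (sym (ℕ.+-suc m n)))) (^-homo-* (+ 1 / b) (suc m) (suc n))

^ℤ-^ : ∀ b .{{_ : NonZero b}} i n → (b ^ℤ i) ^ n ≡ b ^ℤ (i ℤ.* + n)
^ℤ-^ b i zero    = cong (b ^ℤ_) (sym (ℤ.*-zeroʳ i))
^ℤ-^ b i (suc n) = begin
  b ^ℤ i * (b ^ℤ i) ^ n         ≡⟨ cong (b ^ℤ i *_) (^ℤ-^ b i n) ⟩
  b ^ℤ i * b ^ℤ (i ℤ.* + n)     ≡⟨ sym (^ℤ-+ b i (i ℤ.* + n)) ⟩
  b ^ℤ (i ℤ.+ i ℤ.* + n)        ≡⟨ cong (b ^ℤ_) (sym (ℤ.*-suc i (+ n))) ⟩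
  b ^ℤ (i ℤ.* + suc n)          ∎
  where open ≡-Reasoning

^ℤ-mono-≤ : ∀ b .{{_ : NonZero b}} {i j} → i ℤ.≤ j → b ^ℤ i ℚ.≤ b ^ℤ j
^ℤ-mono-≤ b {i} {j} i≤j = begin
  b ^ℤ i                    ≡⟨ sym (ℚ.*-identityʳ _) ⟩
  b ^ℤ i * 1ℚ               ≤⟨ *-mono-≤ (0≤^ℤ b i) ℚ.≤-refl 0≤1 (1≤bⁿ (ℤ.i≤j⇒0≤j-i i≤j)) ⟩
  b ^ℤ i * b ^ℤ (j ℤ.- i)   ≡⟨ sym (^ℤ-+ b i (j ℤ.- i)) ⟩
  b ^ℤ (i ℤ.+ (j ℤ.- i))    ≡⟨ cong (b ^ℤ_) (trans (ℤ.+-comm i _) (trans (ℤ.+-assoc j _ i)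
                                (trans (cong (λ z → j ℤ.+ z) (ℤ.+-inverseˡ i)) (ℤ.+-identityʳ j)))) ⟩
  b ^ℤ j                    ∎
  where
  open ℚ.≤-Reasoning
  1≤bⁿ : ∀ {l} → ℤ.0ℤ ℤ.≤ l → 1ℚ ℚ.≤ b ^ℤ l
  1≤bⁿ {+ n} _ = 1≤^ n (1≤fromℕ b)

-- Rational exponents

-- With exponents read as fractions: x ≤ b^(a/d) and a/d ≤ i/N give x ≤ b^(i/N).
^≤^ℤ-mono : ∀ b .{{_ : NonZero b}} {x} a i d N .{{_ : NonZero d}} → 0ℚ ℚ.≤ x →
  a ℤ.* + N ℤ.≤ i ℤ.* + d → x ^ d ℚ.≤ b ^ℤ a → x ^ N ℚ.≤ b ^ℤ i
^≤^ℤ-mono b {x} a i d N 0≤x aN≤id xᵈ≤bᵃ = ^-cancelˡ-≤ d (0≤^ℤ b i) (begin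
  (x ^ N) ^ d           ≡⟨ ^-swap x N d ⟩
  (x ^ d) ^ N           ≤⟨ ^-monoˡ-≤ N (^-nonNeg d 0≤x) xᵈ≤bᵃ ⟩
  (b ^ℤ a) ^ N          ≡⟨ ^ℤ-^ b a N ⟩
  b ^ℤ (a ℤ.* + N)      ≤⟨ ^ℤ-mono-≤ b aN≤id ⟩
  b ^ℤ (i ℤ.* + d)      ≡⟨ sym (^ℤ-^ b i d) ⟩
  (b ^ℤ i) ^ d          ∎)
  where open ℚ.≤-Reasoning

-- With exponents read as fractions: b^(a/d) ≤ x and i/N ≤ a/d give b^(i/N) ≤ x.
^ℤ≤^-mono : ∀ b .{{_ : NonZero b}} {x} a i d N .{{_ : NonZero d}} → 0ℚ ℚ.≤ x →
  i ℤ.* + d ℤ.≤ a ℤ.* + N → b ^ℤ a ℚ.≤ x ^ d → b ^ℤ i ℚ.≤ x ^ N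
^ℤ≤^-mono b {x} a i d N 0≤x id≤aN bᵃ≤xᵈ = ^-cancelˡ-≤ d (^-nonNeg N 0≤x) (begin
  (b ^ℤ i) ^ d          ≡⟨ ^ℤ-^ b i d ⟩
  b ^ℤ (i ℤ.* + d)      ≤⟨ ^ℤ-mono-≤ b id≤aN ⟩
  b ^ℤ (a ℤ.* + N)      ≡⟨ sym (^ℤ-^ b a N) ⟩
  (b ^ℤ a) ^ N          ≤⟨ ^-monoˡ-≤ N (0≤^ℤ b a) bᵃ≤xᵈ ⟩
  (x ^ d) ^ N           ≡⟨ ^-swap x d N ⟩
  (x ^ N) ^ d           ∎)
  where open ℚ.≤-Reasoning

-- Reducing the fraction i/N to lowest terms does not change its value.
↥*↧ : ∀ i N .{{_ : NonZero N}} → ↥ (i / N) ℤ.* + N ≡ i ℤ.* + ↧ₙ (i / N)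
↥*↧ i N@(suc N-1) with i / N | ℚ.toℚᵘ-fromℚᵘ (ℚᵘ.mkℚᵘ i N-1)
... | ℚ.mkℚ _ _ _ | ℚᵘ.*≡* eq = eq

↧ₙ-nonZero : ∀ r → NonZero (↧ₙ r)
↧ₙ-nonZero (ℚ.mkℚ _ _ _) = _

infix 4 _≤[_]^_

-- x ≤ b^r for rational x ≥ 0 and r. As b^r may be irrational, both sides are raised to
-- the denominator of r. The wrapping in a record lets unification recover x, b and r.
record _≤[_]^_ (x : ℚ) (b : ℕ) .{{_ : NonZero b}} (r : ℚ) : Set where
  constructor pow≤
  field unpow≤ : x ^ ↧ₙ r ℚ.≤ b ^ℤ ↥ r
open _≤[_]^_ public

module _ {b : ℕ} .{{_ : NonZero b}} where

  ≤^-/ : ∀ {x} i N .{{_ : NonZero N}} → 0ℚ ℚ.≤ x → x ^ N ℚ.≤ b ^ℤ i → x ≤[ b ]^ (i / N)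
  ≤^-/ i N 0≤x le = pow≤ (^≤^ℤ-mono b i (↥ (i / N)) N (↧ₙ (i / N)) 0≤x
    (ℤ.≤-reflexive (sym (↥*↧ i N))) le)

  ≤^-/⁻¹ : ∀ {x} i N .{{_ : NonZero N}} → 0ℚ ℚ.≤ x → x ≤[ b ]^ (i / N) → x ^ N ℚ.≤ b ^ℤ i
  ≤^-/⁻¹ i N 0≤x (pow≤ le) = ^≤^ℤ-mono b (↥ (i / N)) i (↧ₙ (i / N)) N {{↧ₙ-nonZero (i / N)}} 0≤x
    (ℤ.≤-reflexive (↥*↧ i N)) le

  ≤^-monoʳ : ∀ {x r r′} → 0ℚ ℚ.≤ x → r ℚ.≤ r′ → x ≤[ b ]^ r → x ≤[ b ]^ r′
  ≤^-monoʳ {x} {r} {r′} 0≤x r≤r′ (pow≤ le) = pow≤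
    (^≤^ℤ-mono b (↥ r) (↥ r′) (↧ₙ r) (↧ₙ r′) {{↧ₙ-nonZero r}} 0≤x (ℚ.drop-*≤* r≤r′) le)

  ≤^-monoˡ : ∀ {x y r} → 0ℚ ℚ.≤ x → x ℚ.≤ y → y ≤[ b ]^ r → x ≤[ b ]^ r
  ≤^-monoˡ {r = r} 0≤x x≤y (pow≤ le) = pow≤ (ℚ.≤-trans (^-monoˡ-≤ (↧ₙ r) 0≤x x≤y) le)

  ≤^-* : ∀ {x y r r′} → 0ℚ ℚ.≤ x → 0ℚ ℚ.≤ y →
    x ≤[ b ]^ r → y ≤[ b ]^ r′ → x * y ≤[ b ]^ (r + r′)
  ≤^-* {x} {y} {r@(ℚ.mkℚ a d-1 _)} {r′@(ℚ.mkℚ a′ d′-1 _)} 0≤x 0≤y (pow≤ x≤) (pow≤ y≤) =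
    ≤^-/ (a ℤ.* + d′ ℤ.+ a′ ℤ.* + d) (d ℕ.* d′) (*-nonNeg 0≤x 0≤y) (begin
      (x * y) ^ (d ℕ.* d′)                    ≡⟨ ^-distrib-* x y (d ℕ.* d′) ⟩
      x ^ (d ℕ.* d′) * y ^ (d ℕ.* d′)         ≡⟨ cong₂ _*_ (sym (^-assocʳ x d d′))
                                                  (trans (cong (y ^_) (ℕ.*-comm d d′)) (sym (^-assocʳ y d′ d))) ⟩
      (x ^ d) ^ d′ * (y ^ d′) ^ d             ≤⟨ *-mono-≤ (^-nonNeg d′ (^-nonNeg d 0≤x))
                                                  (^-monoˡ-≤ d′ (^-nonNeg d 0≤x) x≤)
                                                  (^-nonNeg d (^-nonNeg d′ 0≤y))
                                                  (^-monoˡ-≤ d (^-nonNeg d′ 0≤y) y≤) ⟩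
      (b ^ℤ a) ^ d′ * (b ^ℤ a′) ^ d           ≡⟨ cong₂ _*_ (^ℤ-^ b a d′) (^ℤ-^ b a′ d) ⟩
      b ^ℤ (a ℤ.* + d′) * b ^ℤ (a′ ℤ.* + d)   ≡⟨ sym (^ℤ-+ b (a ℤ.* + d′) (a′ ℤ.* + d)) ⟩
      b ^ℤ (a ℤ.* + d′ ℤ.+ a′ ℤ.* + d)        ∎)
    where
    open ℚ.≤-Reasoning
    d  = suc d-1
    d′ = suc d′-1

  ≤^0 : ∀ {x} → x ≤[ b ]^ 0ℚ → x ℚ.≤ 1ℚ
  ≤^0 {x} (pow≤ le) = subst (ℚ._≤ 1ℚ) (ℚ.*-identityʳ x) le

  1≤^0 : 1ℚ ≤[ b ]^ 0ℚ
  1≤^0 = pow≤ ℚ.≤-refl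

  ≤^-^ : ∀ {x r} n → 0ℚ ℚ.≤ x → x ≤[ b ]^ r → x ^ n ≤[ b ]^ (fromℕ n * r)
  ≤^-^ {x} {r} zero    0≤x x≤ = subst (1ℚ ≤[ b ]^_) (sym (ℚ.*-zeroˡ r)) 1≤^0
  ≤^-^ {x} {r} (suc n) 0≤x x≤ = subst (x ^ suc n ≤[ b ]^_) eq
    (≤^-* 0≤x (^-nonNeg n 0≤x) x≤ (≤^-^ n 0≤x x≤))
    where
    eq : r + fromℕ n * r ≡ fromℕ (suc n) * r
    eq = begin
      r + fromℕ n * r           ≡⟨ cong (_+ fromℕ n * r) (sym (ℚ.*-identityˡ r)) ⟩
      1ℚ * r + fromℕ n * r      ≡⟨ sym (ℚ.*-distribʳ-+ r 1ℚ (fromℕ n)) ⟩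
      (1ℚ + fromℕ n) * r        ≡⟨ cong (_* r) (sym (fromℕ-suc n)) ⟩
      fromℕ (suc n) * r         ∎
      where open ≡-Reasoning

-- Existence of exponents

-- With h = 1 - x and N h ≥ b, Bernoulli's inequality gives x^N (1 + N h) ≤ 1, hence
-- x^N ≤ 1/b, and ε = 1/N works.
<1⇒≤^negative : ∀ b .{{_ : NonZero b}} {x} → 0ℚ ℚ.≤ x → x ℚ.< 1ℚ →
  ∃[ ε ] 0ℚ ℚ.< ε × x ≤[ b ]^ (- ε)
<1⇒≤^negative b {x} 0≤x x<1 = go N {{proj₁ (proj₂ ∃N)}} (proj₂ (proj₂ ∃N))
  where
  h = 1ℚ ℚ.- x
  0<h : 0ℚ ℚ.< h
  0<h = subst (ℚ._< h) (ℚ.+-inverseʳ x) (ℚ.+-monoˡ-< (- x) x<1)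
  ∃N = archimedean⁺ (fromℕ b) 0<h
  N = proj₁ ∃N
  h≤1 : h ℚ.≤ 1ℚ
  h≤1 = subst (h ℚ.≤_) (ℚ.+-identityʳ 1ℚ) (ℚ.+-monoʳ-≤ 1ℚ (ℚ.neg-antimono-≤ 0≤x))
  1-h≡x : 1ℚ ℚ.- h ≡ x
  1-h≡x = solve 1 (λ x → con 1ℚ :+ (:- (con 1ℚ :+ (:- x))) := x) refl x
    where
    open +-*-Solver using (solve; _:+_; :-_; _:=_; con)
  go : ∀ N .{{_ : NonZero N}} → fromℕ b ℚ.≤ fromℕ N * h → ∃[ ε ] 0ℚ ℚ.< ε × x ≤[ b ]^ (- ε)
  go N b≤Nh = + 1 / N , 1/-pos N , ≤^-/ -[1+ 0 ] N 0≤x (begin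
    x ^ N                                ≡⟨ sym (ℚ.*-identityʳ _) ⟩
    x ^ N * 1ℚ                           ≡⟨ cong (x ^ N *_) (sym (n*1/n b)) ⟩
    x ^ N * (fromℕ b * (+ 1 / b))        ≡⟨ sym (ℚ.*-assoc (x ^ N) (fromℕ b) (+ 1 / b)) ⟩
    x ^ N * fromℕ b * (+ 1 / b)          ≤⟨ ℚ.*-monoʳ-≤-nonNeg (+ 1 / b) {{ℚ.nonNegative (0≤1/ b)}} xᴺb≤1 ⟩
    1ℚ * (+ 1 / b)                       ≡⟨ ℚ.*-comm 1ℚ (+ 1 / b) ⟩
    (+ 1 / b) * 1ℚ                       ∎)
    where
    open ℚ.≤-Reasoning
    xᴺb≤1 : x ^ N * fromℕ b ℚ.≤ 1ℚ
    xᴺb≤1 = begin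
      x ^ N * fromℕ b                      ≤⟨ ℚ.*-monoˡ-≤-nonNeg (x ^ N) {{ℚ.nonNegative (^-nonNeg N 0≤x)}}
                                               (ℚ.≤-trans b≤Nh (subst (ℚ._≤ 1ℚ + fromℕ N * h) (ℚ.+-identityˡ _)
                                                 (ℚ.+-monoˡ-≤ (fromℕ N * h) 0≤1))) ⟩
      x ^ N * (1ℚ + fromℕ N * h)           ≡⟨ cong (λ z → z ^ N * (1ℚ + fromℕ N * h)) (sym 1-h≡x) ⟩
      (1ℚ ℚ.- h) ^ N * (1ℚ + fromℕ N * h)  ≤⟨ bernoulli N (ℚ.<⇒≤ 0<h) h≤1 ⟩
      1ℚ                                   ∎

-- The integer part of log_b y.
integer-log : ∀ b .{{_ : NonTrivial b}} {y} → 1ℚ ℚ.≤ y →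
  ∃[ i ] fromℕ b ^ i ℚ.≤ y × y ℚ.< fromℕ b ^ suc i
integer-log b@(suc (suc _)) {y} 1≤y = search (suc j₀)
  (ℚ.≤-<-trans (ℚ.≤-trans (proj₂ (archimedean y)) (n≤b^n b j₀)) (^-sucʳ-< j₀ (1<fromℕ b)))
  where
  j₀ = proj₁ (archimedean y)
  search : ∀ j → y ℚ.< fromℕ b ^ j → ∃[ i ] fromℕ b ^ i ℚ.≤ y × y ℚ.< fromℕ b ^ suc i
  search zero    y<1 = ⊥-elim (ℚ.<-irrefl refl (ℚ.<-≤-trans y<1 1≤y))
  search (suc j) y<  with fromℕ b ^ j ℚ.≤? y
  ... | yes bʲ≤y = j , bʲ≤y , y<
  ... | no  bʲ≰y = search j (ℚ.≰⇒> bʲ≰y)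

-- log_b x lies in [r, r + ε]: take r = i/N, where i is the integer part of log_b (x^N)
-- and 1/N ≤ ε.
approx-log : ∀ b .{{_ : NonTrivial b}} .{{_ : NonZero b}} {x ε} → 1ℚ ℚ.≤ x → 0ℚ ℚ.< ε →
  ∃[ r ] b ^ℤ ↥ r ℚ.≤ x ^ ↧ₙ r × x ≤[ b ]^ (r + ε)
approx-log b {x} {ε} 1≤x 0<ε = go N {{proj₁ (proj₂ ∃N)}} (proj₂ (proj₂ ∃N))
  where
  0≤x = ℚ.≤-trans 0≤1 1≤x
  ∃N = archimedean⁺ 1ℚ 0<ε
  N = proj₁ ∃N
  go : ∀ N .{{_ : NonZero N}} → 1ℚ ℚ.≤ fromℕ N * ε →
    ∃[ r ] b ^ℤ ↥ r ℚ.≤ x ^ ↧ₙ r × x ≤[ b ]^ (r + ε)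
  go N 1≤Nε with integer-log b (1≤^ N 1≤x)
  ... | i , bⁱ≤xᴺ , xᴺ<b¹⁺ⁱ = + i / N
    , ^ℤ≤^-mono b (+ i) (↥ (+ i / N)) N (↧ₙ (+ i / N)) 0≤x (ℤ.≤-reflexive (↥*↧ (+ i) N)) bⁱ≤xᴺ
    , ≤^-monoʳ 0≤x (subst (ℚ._≤ + i / N + ε) (suc-/ i N) (ℚ.+-monoʳ-≤ (+ i / N) (1/-≤ N 1≤Nε)))
        (≤^-/ (+ suc i) N 0≤x (ℚ.<⇒≤ xᴺ<b¹⁺ⁱ))

-- Real arithmetic

infixl 7 _÷ℝ_

-- Division of a real by a positive natural number: p < x / n when p n < x.
_÷ℝ_ : ℝ → (n : ℕ) → .{{_ : NonZero n}} → ℝ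
x ÷ℝ n = record
  { lower     = λ p → lower x (p * fromℕ n)
  ; inhabited = let p , xp = ℝ.inhabited x
                in p * (+ 1 / n) , subst (lower x) (sym (x*1/n*n≡x n p)) xp
  ; bounded   = let p , ¬xp = ℝ.bounded x
                in p * (+ 1 / n) , λ xp → ¬xp (subst (lower x) (x*1/n*n≡x n p) xp)
  ; closed    = λ p<q → ℝ.closed x (*-monoˡ-< (0<fromℕ n) p<q)
  ; rounded   = λ {p} xpn → let q , pn<q , xq = ℝ.rounded x xpn
                in q * (+ 1 / n)
                 , subst (ℚ._< q * (+ 1 / n)) (x*n*1/n≡x n p) (*-monoˡ-< (1/-pos n) pn<q)
                 , subst (lower x) (sym (x*1/n*n≡x n q)) xq
  }

-- The lower cut of x u, for a rational u > 0, consists of the r < a u with a < x. This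
-- direction does not need u > 0, since r is below both a c and a d while c < u < d.
lower-*ℝ⁻ : ∀ x {u r} → lower (x *ℝ fromℚ u) r → ∃[ a ] lower x a × r ℚ.< a * u
lower-*ℝ⁻ x {u} {r} (box {a} {b} {c} {d} xa xb c<u (d′ , d′<d , u≤d′) r<ac r<ad r<bc r<bd) =
  a , xa , subst (r ℚ.<_) (ℚ.*-comm u a)
    ([ ℚ.<-≤-trans (subst (r ℚ.<_) (ℚ.*-comm a c) r<ac)
     , ℚ.<-≤-trans (subst (r ℚ.<_) (ℚ.*-comm a d) r<ad) ]′
      (endpoint≤ a (ℚ.<⇒≤ c<u) (ℚ.≤-trans (ℚ.≮⇒≥ u≤d′) (ℚ.<⇒≤ d′<d))))

-- The converse: the interval around u is (u - u θ, u + u η), with θ and η small enough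
-- that r stays below the products of its endpoints with a. The left endpoint is
-- nonnegative, so replacing a by an upper bound b of x does not decrease them.
lower-*ℝ⁺ : ∀ x {u a r} → 0ℚ ℚ.< u → lower x a → r ℚ.< a * u → lower (x *ℝ fromℚ u) r
lower-*ℝ⁺ x {u} {a} {r} 0<u xa r<au =
  box xa (proj₂ ∃b) (shrink 0<θ) (u , grow 0<η , ℚ.<-irrefl refl)
    r<ac r<ad (ℚ.<-≤-trans r<ac (a*≤b* 0≤c)) (ℚ.<-≤-trans r<ad (a*≤b* 0≤d))
  where
  open +-*-Solver using (solve; _:+_; _:*_; :-_; _:=_; con)
  ∃b = upper-inhabited x
  b = proj₁ ∃b
  h = a * u ℚ.- r
  0<h : 0ℚ ℚ.< h
  0<h = subst (ℚ._< h) (ℚ.+-inverseʳ r) (ℚ.+-monoˡ-< (- r) r<au)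
  ∃θ = small-multiple (a * u) 0<h
  ∃η = small-multiple (- (a * u)) 0<h
  θ = proj₁ ∃θ
  η = proj₁ ∃η
  0<θ = proj₁ (proj₂ ∃θ)
  0<η = proj₁ (proj₂ ∃η)
  c = u ℚ.- u * θ
  d = u + u * η
  0<u* : ∀ {z} → 0ℚ ℚ.< z → 0ℚ ℚ.< u * z
  0<u* {z} 0<z = subst (ℚ._< u * z) (ℚ.*-zeroˡ z) (*-monoˡ-< 0<z 0<u)
  shrink : ∀ {z} → 0ℚ ℚ.< z → u ℚ.- u * z ℚ.< u
  shrink {z} 0<z = subst (u ℚ.- u * z ℚ.<_) (ℚ.+-identityʳ u)
    (ℚ.+-mono-≤-< (ℚ.≤-refl {u}) (ℚ.neg-antimono-< (0<u* 0<z)))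
  grow : ∀ {z} → 0ℚ ℚ.< z → u ℚ.< u + u * z
  grow {z} 0<z = subst (ℚ._< u + u * z) (ℚ.+-identityʳ u)
    (ℚ.+-mono-≤-< (ℚ.≤-refl {u}) (0<u* 0<z))
  0≤c : 0ℚ ℚ.≤ c
  0≤c = ℚ.<⇒≤ (subst₂ ℚ._<_ (ℚ.*-zeroˡ u) (eq θ u) (*-monoˡ-< 0<u 0<1-θ))
    where
    0<1-θ : 0ℚ ℚ.< 1ℚ ℚ.- θ
    0<1-θ = subst (ℚ._< 1ℚ ℚ.- θ) (ℚ.+-inverseʳ θ)
      (ℚ.+-monoˡ-< (- θ) (proj₁ (proj₂ (proj₂ ∃θ))))
    eq : ∀ θ u → (1ℚ ℚ.- θ) * u ≡ u ℚ.- u * θ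
    eq = solve 2 (λ θ u → (con 1ℚ :+ (:- θ)) :* u := u :+ (:- (u :* θ))) refl
  0≤d : 0ℚ ℚ.≤ d
  0≤d = ℚ.<⇒≤ (ℚ.<-trans 0<u (grow 0<η))
  a*≤b* : ∀ {z} → 0ℚ ℚ.≤ z → a * z ℚ.≤ b * z
  a*≤b* {z} 0≤z = ℚ.*-monoʳ-≤-nonNeg z {{ℚ.nonNegative 0≤z}} (ℚ.<⇒≤ (lower<upper x xa (proj₂ ∃b)))
  r<ac : r ℚ.< a * c
  r<ac = subst₂ ℚ._<_ (eq₁ (a * u) r) (eq₂ a u θ)
    (ℚ.+-mono-≤-< (ℚ.≤-refl {a * u}) (ℚ.neg-antimono-< (proj₂ (proj₂ (proj₂ ∃θ)))))
    where
    eq₁ : ∀ z r → z + - (z ℚ.- r) ≡ r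
    eq₁ = solve 2 (λ z r → z :+ (:- (z :+ (:- r))) := r) refl
    eq₂ : ∀ a u θ → a * u + - (a * u * θ) ≡ a * (u ℚ.- u * θ)
    eq₂ = solve 3 (λ a u θ → a :* u :+ (:- (a :* u :* θ)) := a :* (u :+ (:- (u :* θ)))) refl
  r<ad : r ℚ.< a * d
  r<ad = subst₂ ℚ._<_ (eq₁ (a * u) r) (eq₂ a u η)
    (ℚ.+-mono-≤-< (ℚ.≤-refl {a * u}) (ℚ.neg-antimono-< (proj₂ (proj₂ (proj₂ ∃η)))))
    where
    eq₁ : ∀ z r → z + - (z ℚ.- r) ≡ r
    eq₁ = solve 2 (λ z r → z :+ (:- (z :+ (:- r))) := r) refl
    eq₂ : ∀ a u η → a * u + - (- (a * u) * η) ≡ a * (u + u * η)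
    eq₂ = solve 3 (λ a u η → a :* u :+ (:- ((:- (a :* u)) :* η)) := a :* (u :+ u :* η)) refl

÷ℝ*ℝ : ∀ x n .{{_ : NonZero n}} → x ÷ℝ n *ℝ natℝ n ≃ℝ x
÷ℝ*ℝ x n = (λ {p} lt → let a , xan , p<an = lower-*ℝ⁻ (x ÷ℝ n) lt in ℝ.closed x p<an xan)
  , λ {p} xp → let q , p<q , xq = ℝ.rounded x xp in
      lower-*ℝ⁺ (x ÷ℝ n) {a = q * (+ 1 / n)} (0<fromℕ n) (subst (lower x) (sym (x*1/n*n≡x n q)) xq)
        (subst (p ℚ.<_) (sym (x*1/n*n≡x n q)) p<q)

-- A rational below (-u) y is below (-u) d for some rational d > y. The sign of u is
-- irrelevant: -u lies between a and b, and r is below both a d and b d.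
lower-neg-*ℝ : ∀ u y {r} → lower (-ℝ fromℚ u *ℝ y) r → ∃[ d ] upper y d × r ℚ.< - u * d
lower-neg-*ℝ u y {r} (box {a} {b} {c} {d} (t , a<t , -t≮u) (b′ , b′<b , ¬b′) yc yd r<ac r<ad r<bc r<bd) =
  d , yd , [ ℚ.<-≤-trans r<ad , ℚ.<-≤-trans r<bd ]′ (endpoint≤ d a≤-u -u≤b)
  where
  a≤-u : a ℚ.≤ - u
  a≤-u = ℚ.<⇒≤ (ℚ.<-≤-trans a<t (subst (ℚ._≤ - u) (neg-neg t) (ℚ.neg-antimono-≤ (ℚ.≮⇒≥ -t≮u))))
  -u≤b : - u ℚ.≤ b
  -u≤b = ℚ.≤-trans (ℚ.≮⇒≥ λ b′<-u → ¬b′ (- u , b′<-u , ℚ.<-irrefl (neg-neg u))) (ℚ.<⇒≤ b′<b)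

^ℝ-mono : ∀ b .{{_ : NonZero b}} {x y} → x ≤ℝ y → b ^ℝ x ≤ℝ b ^ℝ y
^ℝ-mono b x≤y (s , r , p<s , 0≤s , xr , s≤bʳ) = s , r , p<s , 0≤s , x≤y xr , s≤bʳ

-- A rational p below the product b^x b′^y is below s t for some s and t bounded by
-- powers with exponents r < x and r′ < y. These are witnesses of the lower bounds of
-- the box around (b^x, b′^y). They lie in the box, and p is below the products at its
-- corners, so p < s t.
^ℝ*^ℝ⁻ : ∀ b b′ .{{_ : NonZero b}} .{{_ : NonZero b′}} x y {p} → lower (b ^ℝ x *ℝ b′ ^ℝ y) p →
  ∃[ s ] ∃[ t ] p ℚ.< s * t ×
    (0ℚ ℚ.≤ s × ∃[ r ] lower x r × s ≤[ b ]^ r) ×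
    (0ℚ ℚ.≤ t × ∃[ r ] lower y r × t ≤[ b′ ]^ r)
^ℝ*^ℝ⁻ b b′ x y {p} (box {β} {γ} {c} {d} (s , r , β<s , 0≤s , xr , s≤) (γ′ , γ′<γ , ¬γ′)
    (t , r′ , c<t , 0≤t , yr′ , t≤) (d′ , d′<d , ¬d′) p<βc p<βd p<γc p<γd) =
  s , t , subst (p ℚ.<_) (ℚ.*-comm t s)
    ([ ℚ.<-≤-trans (subst (p ℚ.<_) (ℚ.*-comm s c) p<sc)
     , ℚ.<-≤-trans (subst (p ℚ.<_) (ℚ.*-comm s d) p<sd) ]′ (endpoint≤ s (ℚ.<⇒≤ c<t) t≤d))
    , (0≤s , r , xr , pow≤ s≤) , (0≤t , r′ , yr′ , pow≤ t≤)
  where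
  s≤γ : s ℚ.≤ γ
  s≤γ = ℚ.≤-trans (ℚ.≮⇒≥ λ γ′<s → ¬γ′ (s , r , γ′<s , 0≤s , xr , s≤)) (ℚ.<⇒≤ γ′<γ)
  t≤d : t ℚ.≤ d
  t≤d = ℚ.≤-trans (ℚ.≮⇒≥ λ d′<t → ¬d′ (t , r′ , d′<t , 0≤t , yr′ , t≤)) (ℚ.<⇒≤ d′<d)
  p<sc : p ℚ.< s * c
  p<sc = [ ℚ.<-≤-trans p<βc , ℚ.<-≤-trans p<γc ]′ (endpoint≤ c (ℚ.<⇒≤ β<s) s≤γ)
  p<sd : p ℚ.< s * d
  p<sd = [ ℚ.<-≤-trans p<βd , ℚ.<-≤-trans p<γd ]′ (endpoint≤ d (ℚ.<⇒≤ β<s) s≤γ)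

-- The defining property of logℝ b x. It holds by definition once b is known to have
-- the form suc (suc _), on which logℝ is defined.
lower-logℝ⁻ : ∀ b .{{_ : NonTrivial b}} .{{_ : NonZero b}} x .{{_ : Positive x}} {p} →
  lower (logℝ b x) p → ∃[ r ] p ℚ.< r × b ^ℤ ↥ r ℚ.≤ x ^ ↧ₙ r
lower-logℝ⁻ (suc (suc _)) x lt = lt

lower-logℝ⁺ : ∀ b .{{_ : NonTrivial b}} .{{_ : NonZero b}} x .{{_ : Positive x}} {p} →
  ∃[ r ] p ℚ.< r × b ^ℤ ↥ r ℚ.≤ x ^ ↧ₙ r → lower (logℝ b x) p
lower-logℝ⁺ (suc (suc _)) x lt = lt

-- If p < -log_b x then x ≤ b^(-p).
lower-neg-logℝ : ∀ b .{{_ : NonTrivial b}} .{{_ : NonZero b}} x .{{_ : Positive x}} {p} →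
  lower (-ℝ logℝ b x) p → x ≤[ b ]^ (- p)
lower-neg-logℝ b x {p} (t , p<t , ¬log) = pow≤ (ℚ.<⇒≤ (ℚ.≰⇒> λ le →
  ¬log (lower-logℝ⁺ b x (- p , ℚ.neg-antimono-< p<t , le))))

-- b^(log_b x) = x.
^ℝ-logℝ : ∀ b .{{_ : NonTrivial b}} .{{_ : NonZero b}} x .{{_ : Positive x}} → 1ℚ ℚ.≤ x →
  b ^ℝ logℝ b x ≃ℝ fromℚ x
^ℝ-logℝ b x 1≤x = to≤ , from≤
  where
  0<x : 0ℚ ℚ.< x
  0<x = ℚ.positive⁻¹ x
  to≤ : b ^ℝ logℝ b x ≤ℝ fromℚ x
  to≤ {p} (s , r , p<s , 0≤s , log-r , s≤) with lower-logℝ⁻ b x log-r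
  ... | r′ , r<r′ , ≤x = ℚ.<-≤-trans p<s (^-cancelˡ-≤ (↧ₙ r′) {{↧ₙ-nonZero r′}} (ℚ.<⇒≤ 0<x)
    (ℚ.≤-trans (unpow≤ (≤^-monoʳ 0≤s (ℚ.<⇒≤ r<r′) (pow≤ s≤))) ≤x))
  -- Given p < x, choose t between p and x with t ≥ 0. Then t / x ≤ b^(-ε) for some ε > 0,
  -- and x ≤ b^(r + ε′) for some r ≤ log_b x and ε′ < ε. Hence t ≤ b^(-ε + r + ε′), whose
  -- exponent is less than log_b x.
  from≤ : fromℚ x ≤ℝ b ^ℝ logℝ b x
  from≤ {p} p<x = t , - ε + (r + ε′) , p<t , 0≤t
    , lower-logℝ⁺ b x (r , ρ<r , proj₁ (proj₂ ∃r))
    , unpow≤ (subst (_≤[ b ]^ (- ε + (r + ε′))) (t/x*x) (≤^-* 0≤t/x (ℚ.<⇒≤ 0<x)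
        (proj₂ (proj₂ ∃ε)) (proj₂ (proj₂ ∃r))))
    where
    p⊔0<x : p ℚ.⊔ 0ℚ ℚ.< x
    p⊔0<x = [ (λ p≤0 → subst (ℚ._< x) (sym (ℚ.p≤q⇒p⊔q≡q p≤0)) 0<x)
            , (λ 0≤p → subst (ℚ._< x) (sym (ℚ.p≥q⇒p⊔q≡p 0≤p)) p<x) ]′ (ℚ.≤-total p 0ℚ)
    ∃t = ℚ.<-dense p⊔0<x
    t = proj₁ ∃t
    p<t : p ℚ.< t
    p<t = ℚ.≤-<-trans (ℚ.p≤p⊔q p 0ℚ) (proj₁ (proj₂ ∃t))
    0≤t : 0ℚ ℚ.≤ t
    0≤t = ℚ.<⇒≤ (ℚ.≤-<-trans (ℚ.p≤q⊔p p 0ℚ) (proj₁ (proj₂ ∃t)))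
    instance
      x≢0 : ℚ.NonZero x
      x≢0 = ℚ.pos⇒nonZero x
    x⁻¹ = ℚ.1/ x
    0<x⁻¹ : 0ℚ ℚ.< x⁻¹
    0<x⁻¹ = ℚ.positive⁻¹ x⁻¹ {{ℚ.1/pos⇒pos x}}
    0≤t/x : 0ℚ ℚ.≤ t * x⁻¹
    0≤t/x = *-nonNeg 0≤t (ℚ.<⇒≤ 0<x⁻¹)
    t/x*x : t * x⁻¹ * x ≡ t
    t/x*x = trans (ℚ.*-assoc t x⁻¹ x) (trans (cong (t *_) (ℚ.*-inverseˡ x)) (ℚ.*-identityʳ t))
    ∃ε = <1⇒≤^negative b 0≤t/x
      (subst (t * x⁻¹ ℚ.<_) (ℚ.*-inverseʳ x) (*-monoˡ-< 0<x⁻¹ (proj₂ (proj₂ ∃t))))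
    ε = proj₁ ∃ε
    ∃ε′ = ℚ.<-dense (proj₁ (proj₂ ∃ε))
    ε′ = proj₁ ∃ε′
    ∃r = approx-log b 1≤x (proj₁ (proj₂ ∃ε′))
    r = proj₁ ∃r
    ρ<r : - ε + (r + ε′) ℚ.< r
    ρ<r = subst₂ ℚ._<_ (ℚ.+-comm (r + ε′) (- ε)) (eq r ε)
      (ℚ.+-monoˡ-< (- ε) (ℚ.+-mono-≤-< (ℚ.≤-refl {r}) (proj₂ (proj₂ ∃ε′))))
      where
      open +-*-Solver using (solve; _:+_; :-_; _:=_)
      eq : ∀ r ε → r + ε + - ε ≡ r
      eq = solve 2 (λ r ε → r :+ ε :+ (:- ε) := r) refl

-- From entropy to size

0≤logℝ÷ : ∀ b .{{_ : NonTrivial b}} .{{_ : NonZero b}} x .{{_ : Positive x}} n .{{_ : NonZero n}} →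
  1ℚ ℚ.≤ x → 0ℝ ≤ℝ logℝ b x ÷ℝ n
0≤logℝ÷ b x n 1≤x {p} p<0 = lower-logℝ⁺ b x (0ℚ , subst (p * fromℕ n ℚ.<_) (ℚ.*-zeroˡ (fromℕ n)) (*-monoˡ-< (0<fromℕ n) p<0)
  , subst (1ℚ ℚ.≤_) (sym (ℚ.*-identityʳ x)) 1≤x)

logℝ÷≤1 : ∀ b .{{_ : NonTrivial b}} .{{_ : NonZero b}} x .{{_ : Positive x}} n .{{_ : NonZero n}} →
  x ℚ.≤ fromℕ b ^ n → logℝ b x ÷ℝ n ≤ℝ 1ℝ
logℝ÷≤1 b x n x≤bⁿ {p} lt =
  let r , pn<r , bʳ≤x = lower-logℝ⁻ b x lt
  in ℚ.*-cancelʳ-<-nonNeg (fromℕ n) {{ℚ.nonNegative (0≤fromℕ n)}}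
       (subst (p * fromℕ n ℚ.<_) (sym (ℚ.*-identityˡ (fromℕ n)))
         (ℚ.<-≤-trans pn<r (ℚ.≮⇒≥ λ n<r → absurd r (<↥ r n n<r) bʳ≤x)))
  where
  open ℚ.≤-Reasoning
  absurd : ∀ r → + (n ℕ.* ↧ₙ r) ℤ.< ↥ r → b ^ℤ ↥ r ℚ.≤ x ^ ↧ₙ r → ⊥
  absurd r nd<↥r bʳ≤x = ℚ.<-irrefl refl (begin-strict
    fromℕ b ^ (n ℕ.* ↧ₙ r)          <⟨ ^-sucʳ-< (n ℕ.* ↧ₙ r) (1<fromℕ b) ⟩
    fromℕ b ^ suc (n ℕ.* ↧ₙ r)      ≤⟨ ^ℤ-mono-≤ b (ℤ.i<j⇒suc[i]≤j nd<↥r) ⟩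
    b ^ℤ ↥ r                        ≤⟨ bʳ≤x ⟩
    x ^ ↧ₙ r                        ≤⟨ ^-monoˡ-≤ (↧ₙ r) (ℚ.<⇒≤ (ℚ.positive⁻¹ x)) x≤bⁿ ⟩
    (fromℕ b ^ n) ^ ↧ₙ r            ≡⟨ ^-assocʳ (fromℕ b) n (↧ₙ r) ⟩
    fromℕ b ^ (n ℕ.* ↧ₙ r)          ∎)

-- In the application, s is the size of the set, μ = m/s is the lower bound for the
-- probability of a fibre, and c = n - k. The hypotheses bound X = t^k μ^n s^c by a power
-- of b whose exponent k r - n p + c H is zero, and (t t′)^k ≤ t^k m^n = X s^k.
exponent-count : ∀ b .{{_ : NonZero b}} n k c .{{_ : NonZero k}} {s μ t m t′ r p H} → n ≡ k ℕ.+ c →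
  0ℚ ℚ.< s → 0ℚ ℚ.≤ μ → 0ℚ ℚ.≤ t → 0ℚ ℚ.≤ t′ → μ * s ≡ m →
  t ≤[ b ]^ r → t′ ^ k ℚ.≤ m ^ n → μ ≤[ b ]^ (- p) → s ≤[ b ]^ H →
  p * fromℕ n ≡ r * fromℕ k + H * fromℕ c →
  t * t′ ℚ.≤ s
exponent-count b n k c {s} {μ} {t} {m} {t′} {r} {p} {H} refl 0<s 0≤μ 0≤t 0≤t′ μs≡m t≤ t′≤ μ≤ s≤ p≡ =
  ^-cancelˡ-≤ k 0≤s (begin
    (t * t′) ^ k                          ≡⟨ ^-distrib-* t t′ k ⟩
    t ^ k * t′ ^ k                        ≤⟨ *-mono-≤ (^-nonNeg k 0≤t) ℚ.≤-refl (^-nonNeg k 0≤t′) t′≤ ⟩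
    t ^ k * m ^ n                         ≡⟨ cong (λ z → t ^ k * z ^ n) (sym μs≡m) ⟩
    t ^ k * (μ * s) ^ n                   ≡⟨ cong (t ^ k *_) (^-distrib-* μ s n) ⟩
    t ^ k * (μ ^ n * s ^ n)               ≡⟨ cong (λ z → t ^ k * (μ ^ n * z)) (^-homo-* s k c) ⟩
    t ^ k * (μ ^ n * (s ^ k * s ^ c))     ≡⟨ rearrange (t ^ k) (μ ^ n) (s ^ k) (s ^ c) ⟩
    X * s ^ k                             ≤⟨ ℚ.*-monoʳ-≤-nonNeg (s ^ k) {{ℚ.nonNegative (^-nonNeg k 0≤s)}} X≤1 ⟩
    1ℚ * s ^ k                            ≡⟨ ℚ.*-identityˡ (s ^ k) ⟩
    s ^ k                                 ∎)
  where
  open ℚ.≤-Reasoning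
  open +-*-Solver using (solve; _:+_; _:*_; :-_; _:=_)
  0≤s = ℚ.<⇒≤ 0<s
  X = t ^ k * (μ ^ n * s ^ c)
  rearrange : ∀ a b c d → a * (b * (c * d)) ≡ a * (b * d) * c
  rearrange = solve 4 (λ a b c d → a :* (b :* (c :* d)) := a :* (b :* d) :* c) refl
  exponent≡0 : fromℕ k * r + (fromℕ n * (- p) + fromℕ c * H) ≡ 0ℚ
  exponent≡0 = trans (solve 6 (λ k r n p c H →
      k :* r :+ (n :* (:- p) :+ c :* H) := r :* k :+ H :* c :+ (:- (p :* n)))
      refl (fromℕ k) r (fromℕ n) p (fromℕ c) H)
    (trans (cong (λ z → r * fromℕ k + H * fromℕ c + - z) p≡) (ℚ.+-inverseʳ (r * fromℕ k + H * fromℕ c)))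
  X≤1 : X ℚ.≤ 1ℚ
  X≤1 = ≤^0 (subst (X ≤[ b ]^_) exponent≡0
    (≤^-* (^-nonNeg k 0≤t) (*-nonNeg (^-nonNeg n 0≤μ) (^-nonNeg c 0≤s)) (≤^-^ k 0≤t t≤)
      (≤^-* (^-nonNeg n 0≤μ) (^-nonNeg c 0≤s) (≤^-^ n 0≤μ μ≤) (≤^-^ c 0≤s s≤))))

-- Rational bounds G < log_b x ≤ H that are close enough together for C (H - G) to be
-- less than β - α.
log-gap : ∀ b .{{_ : NonTrivial b}} .{{_ : NonZero b}} {x C α β} .{{_ : Positive x}} → 1ℚ ℚ.≤ x →
  α ℚ.< β →
  ∃[ G ] ∃[ H ] lower (logℝ b x) G × x ≤[ b ]^ H × α + H * C ℚ.< G * C + β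
log-gap b {x} {C} {α} {β} 1≤x α<β = r ℚ.- ε , r + ε
  , lower-logℝ⁺ b x (r , r-ε<r , proj₁ (proj₂ ∃r)) , proj₂ (proj₂ ∃r) , gap
  where
  open +-*-Solver using (solve; _:+_; _:*_; :-_; _:=_)
  ∃ε = small-multiple (C + C) (subst (ℚ._< β ℚ.- α) (ℚ.+-inverseʳ α) (ℚ.+-monoˡ-< (- α) α<β))
  ε = proj₁ ∃ε
  ∃r = approx-log b 1≤x (proj₁ (proj₂ ∃ε))
  r = proj₁ ∃r
  r-ε<r : r ℚ.- ε ℚ.< r
  r-ε<r = subst (r ℚ.- ε ℚ.<_) (ℚ.+-identityʳ r)
    (ℚ.+-monoʳ-< r (ℚ.neg-antimono-< (proj₁ (proj₂ ∃ε))))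
  gap : α + (r + ε) * C ℚ.< (r ℚ.- ε) * C + β
  gap = subst₂ ℚ._<_ (eq₁ α r ε C) (eq₂ α β r ε C)
    (ℚ.+-monoˡ-< (α + (r ℚ.- ε) * C) (proj₂ (proj₂ (proj₂ ∃ε))))
    where
    eq₁ : ∀ α r ε C → (C + C) * ε + (α + (r ℚ.- ε) * C) ≡ α + (r + ε) * C
    eq₁ = solve 4 (λ α r ε C →
      (C :+ C) :* ε :+ (α :+ (r :+ (:- ε)) :* C) := α :+ (r :+ ε) :* C) refl
    eq₂ : ∀ α β r ε C → β ℚ.- α + (α + (r ℚ.- ε) * C) ≡ (r ℚ.- ε) * C + β
    eq₂ = solve 5 (λ α β r ε C →
      β :+ (:- α) :+ (α :+ (r :+ (:- ε)) :* C) := (r :+ (:- ε)) :* C :+ β) refl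

-- Here x is the largest probability of a fibre, and c = n - k.
entropy⇒size : ∀ b .{{_ : NonTrivial b}} .{{_ : NonZero b}} n k c
  .{{_ : NonZero n}} .{{_ : NonZero k}} .{{_ : NonZero c}} → n ≡ k ℕ.+ c →
  ∀ s m .{{_ : NonZero s}} .{{_ : NonZero m}} .{{_ : Positive (fromℕ s)}}
  D x .{{_ : Positive x}} → fromℕ m * (+ 1 / s) ℚ.≤ x →
  (logℝ b (fromℕ s) ÷ℝ n) *ℝ natℝ c -ℝ D ≤ℝ -ℝ logℝ b x →
  b ^ℝ (-ℝ fromℚ (+ n / k) *ℝ D) *ℝ m ^ℝ fromℚ (+ n / k) ≤ℝ natℝ s
entropy⇒size b n k c n≡k+c s m D x μ≤x bound {y} lt =
  let t , t′ , y<tt′ , (0≤t , r , -uD-r , t≤bʳ) , (0≤t′ , r′ , r′<u , t′≤) =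
        ^ℝ*^ℝ⁻ b m (-ℝ fromℚ (+ n / k) *ℝ D) (fromℚ (+ n / k)) lt
      d , (e , e<d , ¬De) , r<-ud = lower-neg-*ℝ (+ n / k) D -uD-r
      G , H , log-G , s≤bᴴ , gap = log-gap b {C = fromℕ c} (1≤fromℕ s) (rk<-dn r<-ud)
  in ℚ.<-≤-trans y<tt′ (exponent-count b n k c n≡k+c (0<fromℕ s) 0≤μ 0≤t 0≤t′
       (x*1/n*n≡x s (fromℕ m)) t≤bʳ
       (≤^-/⁻¹ (+ n) k 0≤t′ (≤^-monoʳ 0≤t′ (ℚ.<⇒≤ r′<u) t′≤))
       (≤^-monoˡ 0≤μ μ≤x (lower-neg-logℝ b x (bound (lower-p e<d ¬De log-G gap))))
       s≤bᴴ (x*1/n*n≡x n (r * fromℕ k + H * fromℕ c)))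
  where
  open +-*-Solver using (solve; _:+_; _:*_; :-_; _:=_)
  0≤μ : 0ℚ ℚ.≤ fromℕ m * (+ 1 / s)
  0≤μ = *-nonNeg (0≤fromℕ m) (0≤1/ s)

  -- r < -u d with u = n/k, multiplied by k.
  rk<-dn : ∀ {r d} → r ℚ.< - (+ n / k) * d → r * fromℕ k ℚ.< - (d * fromℕ n)
  rk<-dn {r} {d} r<-ud = subst (r * fromℕ k ℚ.<_) (eq (+ n / k) d (fromℕ k) (fromℕ n) (n/k*k n k))
    (*-monoˡ-< (0<fromℕ k) r<-ud)
    where
    eq : ∀ u d K N → u * K ≡ N → - u * d * K ≡ - (d * N)
    eq u d K N uK≡N = trans (solve 3 (λ u d K → (:- u) :* d :* K := :- (d :* (u :* K))) refl u d K)
      (cong (λ z → - (d * z)) uK≡N)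

  -- The rational z/n is below δ c - D, as G/n < δ = log_b s / n and D ≤ e < d.
  lower-p : ∀ {z d e G} → e ℚ.< d → ¬ lower D e → lower (logℝ b (fromℕ s)) G →
    z ℚ.< G * fromℕ c + - (d * fromℕ n) →
    lower ((logℝ b (fromℕ s) ÷ℝ n) *ℝ natℝ c -ℝ D) (z * (+ 1 / n))
  lower-p {z} {d} {e} {G} e<d ¬De log-G gap = let a , p+d<a , a<Gιc = ℚ.<-dense p+d<Gιc in
    a , - d
    , lower-*ℝ⁺ (logℝ b (fromℕ s) ÷ℝ n) {a = G * ι} (0<fromℕ c)
        (subst (lower (logℝ b (fromℕ s))) (sym (x*1/n*n≡x n G)) log-G) a<Gιc
    , (- e , ℚ.neg-antimono-< e<d , subst (λ z → ¬ lower D z) (sym (neg-neg e)) ¬De)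
    , subst (ℚ._< a + - d) (eq′ (z * ι) d) (ℚ.+-monoˡ-< (- d) p+d<a)
    where
    ι = + 1 / n
    eq : ∀ G d ι C N → d * N * ι ≡ d → (G * C + - (d * N)) * ι + d ≡ G * ι * C
    eq G d ι C N dNι≡d = trans
      (solve 5 (λ G d ι C N → (G :* C :+ (:- (d :* N))) :* ι :+ d := G :* ι :* C :+ (d :+ (:- (d :* N :* ι))))
        refl G d ι C N)
      (trans (cong (λ z → G * ι * C + (d + - z)) dNι≡d)
        (trans (cong (λ z → G * ι * C + z) (ℚ.+-inverseʳ d)) (ℚ.+-identityʳ (G * ι * C))))
    eq′ : ∀ p d → p + d + - d ≡ p
    eq′ = solve 2 (λ p d → p :+ d :+ (:- d) := p) refl
    p+d<Gιc : z * ι + d ℚ.< G * ι * fromℕ c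
    p+d<Gιc = subst (z * ι + d ℚ.<_) (eq G d ι (fromℕ c) (fromℕ n) (x*n*1/n≡x n d))
      (ℚ.+-monoˡ-< d (*-monoˡ-< (1/-pos n) gap))

-- Linear algebra over a finite field

module LinearAlgebra {q : ℕ} (F : FiniteField q) where
  open FiniteField F
  open FurstenbergSets F
  open IsCommutativeRing isCommutativeRing
    using (+-identityˡ; +-identityʳ; -‿inverseˡ; *-assoc; *-comm; *-identityˡ; *-identityʳ
          ; distribˡ; zeroˡ; zeroʳ)

  +ᵛ-identityʳ : ∀ {n} (v : 𝔽^ n) → v +ᵛ 0ᵛ ≡ v
  +ᵛ-identityʳ = Vec.zipWith-identityʳ +-identityʳ

  +ᵛ-identityˡ : ∀ {n} (v : 𝔽^ n) → 0ᵛ +ᵛ v ≡ v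
  +ᵛ-identityˡ = Vec.zipWith-identityˡ +-identityˡ

  0*ᵛ : ∀ {n} (v : 𝔽^ n) → 0# *ᵛ v ≡ 0ᵛ
  0*ᵛ []      = refl
  0*ᵛ (x ∷ v) = cong₂ _∷_ (zeroˡ x) (0*ᵛ v)

  *ᵛ0 : ∀ c n → c *ᵛ 0ᵛ {n} ≡ 0ᵛ
  *ᵛ0 c n = trans (Vec.map-replicate (c ·_) 0# n) (cong (Vec.replicate n) (zeroʳ c))

  head-+ᵛ : ∀ {n} (u v : 𝔽^ (suc n)) → head (u +ᵛ v) ≡ head u ⊕ head v
  head-+ᵛ (_ ∷ _) (_ ∷ _) = refl

  tail-+ᵛ : ∀ {n} (u v : 𝔽^ (suc n)) → tail (u +ᵛ v) ≡ tail u +ᵛ tail v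
  tail-+ᵛ (_ ∷ _) (_ ∷ _) = refl

  head-*ᵛ : ∀ {n} c (v : 𝔽^ (suc n)) → head (c *ᵛ v) ≡ c · head v
  head-*ᵛ c (_ ∷ _) = refl

  tail-*ᵛ : ∀ {n} c (v : 𝔽^ (suc n)) → tail (c *ᵛ v) ≡ c *ᵛ tail v
  tail-*ᵛ c (_ ∷ _) = refl

  -- Additive and homogeneous maps; the preservation of 0 and of negatives follows.
  record Linear {m n} (f : 𝔽^ m → 𝔽^ n) : Set where
    field
      +-homo : ∀ u v → f (u +ᵛ v) ≡ f u +ᵛ f v
      *-homo : ∀ c v → f (c *ᵛ v) ≡ c *ᵛ f v

    0-homo : f 0ᵛ ≡ 0ᵛ
    0-homo = begin
      f 0ᵛ            ≡⟨ cong f (sym (0*ᵛ 0ᵛ)) ⟩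
      f (0# *ᵛ 0ᵛ)    ≡⟨ *-homo 0# 0ᵛ ⟩
      0# *ᵛ f 0ᵛ      ≡⟨ 0*ᵛ (f 0ᵛ) ⟩
      0ᵛ              ∎
      where open ≡-Reasoning
  open Linear

  isLinear⇒linear : ∀ {m n} {f : 𝔽^ m → 𝔽^ n} → IsLinear f → Linear f
  isLinear⇒linear lin = record { +-homo = +ᴹ-homo ; *-homo = *ₗ-homo }
    where open Morphism.LeftModuleMorphisms.IsLeftModuleHomomorphism lin

  ∘-linear : ∀ {l m n} {f : 𝔽^ m → 𝔽^ n} {g : 𝔽^ l → 𝔽^ m} → Linear f → Linear g → Linear (f ∘ g)
  ∘-linear {f = f} {g} F G = record
    { +-homo = λ u v → trans (cong f (+-homo G u v)) (+-homo F (g u) (g v))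
    ; *-homo = λ c v → trans (cong f (*-homo G c v)) (*-homo F c (g v))
    }

  tail-linear : ∀ {n} → Linear (tail {n = n})
  tail-linear = record { +-homo = tail-+ᵛ ; *-homo = tail-*ᵛ }

  -- An injective linear map from 𝔽^k with image W. Injectivity is stated as triviality
  -- of the kernel.
  record Parametrization {n} (W : Pred (𝔽^ n) 0ℓ) (k : ℕ) : Set where
    field
      map       : 𝔽^ k → 𝔽^ n
      linear    : Linear map
      injective : ∀ x → map x ≡ 0ᵛ → x ≡ 0ᵛ
      sound     : ∀ x → W (map x)
      complete  : ∀ {v} → W v → ∃[ x ] v ≡ map x

  standardBasis : ∀ k → Vec (𝔽^ k) k
  standardBasis zero    = []
  standardBasis (suc k) = (1# ∷ 0ᵛ) ∷ Vec.map (0# ∷_) (standardBasis k)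

  linear-combination : ∀ {k m n} {f : 𝔽^ m → 𝔽^ n} → Linear f → (cs : Vec Carrier k) (vs : Vec (𝔽^ m) k) →
    linearCombination cs (Vec.map f vs) ≡ f (linearCombination cs vs)
  linear-combination {f = f} lin []       []       = sym (0-homo lin)
  linear-combination {f = f} lin (c ∷ cs) (v ∷ vs) = begin
    c *ᵛ f v +ᵛ linearCombination cs (Vec.map f vs)  ≡⟨ cong₂ _+ᵛ_ (sym (*-homo lin c v)) (linear-combination lin cs vs) ⟩
    f (c *ᵛ v) +ᵛ f (linearCombination cs vs)        ≡⟨ sym (+-homo lin _ _) ⟩
    f (c *ᵛ v +ᵛ linearCombination cs vs)            ∎
    where open ≡-Reasoning

  0∷-linear : ∀ {n} → Linear {n} (0# ∷_)
  0∷-linear = record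
    { +-homo = λ u v → cong (_∷ u +ᵛ v) (sym (+-identityˡ 0#))
    ; *-homo = λ c v → cong (_∷ c *ᵛ v) (sym (zeroʳ c))
    }

  standard-combination : ∀ {k} (cs : 𝔽^ k) → linearCombination cs (standardBasis k) ≡ cs
  standard-combination         []       = refl
  standard-combination {suc k} (c ∷ cs) = begin
    c *ᵛ (1# ∷ 0ᵛ) +ᵛ linearCombination cs (Vec.map (0# ∷_) (standardBasis k))
      ≡⟨ cong (c *ᵛ (1# ∷ 0ᵛ) +ᵛ_) (trans (linear-combination 0∷-linear cs (standardBasis k))
                                          (cong (0# ∷_) (standard-combination cs))) ⟩
    c *ᵛ (1# ∷ 0ᵛ) +ᵛ (0# ∷ cs)
      ≡⟨ cong₂ _∷_ (trans (+-identityʳ _) (*-identityʳ c)) (trans (cong (_+ᵛ cs) (*ᵛ0 c k)) (+ᵛ-identityˡ cs)) ⟩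
    c ∷ cs ∎
    where open ≡-Reasoning

  -- The images of the standard basis vectors form a basis of W.
  parametrization⇒dimension : ∀ {n k} {W : Pred (𝔽^ n) 0ℓ} → Parametrization W k → HasDimension W k
  parametrization⇒dimension {n} {k} {W} P = Vec.map map (standardBasis k) , record
    { members     = all-map (standardBasis k)
    ; spanning    = λ Wv → let x , v≡ = complete Wv in x , trans v≡ (sym (combination x))
    ; independent = λ cs eq → injective cs (trans (sym (combination cs)) eq)
    }
    where
    open Parametrization P
    all-map : ∀ {l} (xs : Vec (𝔽^ k) l) → All W (Vec.map map xs)
    all-map []       = []
    all-map (x ∷ xs) = sound x ∷ all-map xs
    combination : ∀ cs → linearCombination cs (Vec.map map (standardBasis k)) ≡ map cs
    combination cs = trans (linear-combination linear cs (standardBasis k))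
      (cong map (standard-combination cs))

  kernel : ∀ {m n} → (𝔽^ m → 𝔽^ n) → Pred (𝔽^ m) 0ℓ
  kernel φ v = φ v ≡ 0ᵛ

  kernel-isSubspace : ∀ {m n} {φ : 𝔽^ m → 𝔽^ n} → Linear φ → IsSubspace (kernel φ)
  kernel-isSubspace lin = record
    { 0-closed = 0-homo lin
    ; +-closed = λ {u} {v} φu≡0 φv≡0 →
        trans (+-homo lin u v) (trans (cong₂ _+ᵛ_ φu≡0 φv≡0) (+ᵛ-identityˡ 0ᵛ))
    ; *-closed = λ c {v} φv≡0 → trans (*-homo lin c v) (trans (cong (c *ᵛ_) φv≡0) (*ᵛ0 c _))
    }

  translate-fibre : ∀ {m n} {φ : 𝔽^ m → 𝔽^ n} → Linear φ →
    ∀ {a v} → translate a (kernel φ) v → φ v ≡ φ a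
  translate-fibre {φ = φ} lin {a} {v} (w , φw≡0 , v≡a+w) = begin
    φ v             ≡⟨ cong φ v≡a+w ⟩
    φ (a +ᵛ w)      ≡⟨ +-homo lin a w ⟩
    φ a +ᵛ φ w      ≡⟨ cong (φ a +ᵛ_) φw≡0 ⟩
    φ a +ᵛ 0ᵛ       ≡⟨ +ᵛ-identityʳ (φ a) ⟩
    φ a             ∎
    where open ≡-Reasoning

  commutativeRing : CommutativeRing 0ℓ 0ℓ
  commutativeRing = record { isCommutativeRing = isCommutativeRing }

  open import Algebra.Properties.Ring (CommutativeRing.ring commutativeRing)
    using (-‿distribˡ-*; -‿distribʳ-*)
  open import Algebra.Properties.Group (CommutativeRing.+-group commutativeRing)
    using (inverseˡ-unique)
  open import Algebra.Properties.CommutativeSemigroup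
    (CommutativeRing.*-commutativeSemigroup commutativeRing) using (x∙yz≈y∙xz; xy∙z≈xz∙y)

  -- A linear form on 𝔽^n.
  record Functional (n : ℕ) : Set where
    field
      at   : 𝔽^ n → Carrier
      at-+ : ∀ u v → at (u +ᵛ v) ≡ at u ⊕ at v
      at-* : ∀ c v → at (c *ᵛ v) ≡ c · at v

    at-0 : at 0ᵛ ≡ 0#
    at-0 = trans (cong at (sym (0*ᵛ 0ᵛ))) (trans (at-* 0# 0ᵛ) (zeroˡ (at 0ᵛ)))

  -- The first coordinate of a linear map.
  headOf : ∀ {m n} {φ : 𝔽^ m → 𝔽^ (suc n)} → Linear φ → Functional m
  headOf {φ = φ} lin = record
    { at   = head ∘ φ
    ; at-+ = λ u v → trans (cong head (+-homo lin u v)) (head-+ᵛ (φ u) (φ v))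
    ; at-* = λ c v → trans (cong head (*-homo lin c v)) (head-*ᵛ c (φ v))
    }

  module _ {n} (f : Functional (suc n)) where
    open Functional f renaming (at-+ to f-+; at-* to f-*)

    -- The coefficient of the first coordinate in the functional.
    leading : Carrier
    leading = at (1# ∷ 0ᵛ)

    -- The restriction of the functional to vectors with first coordinate 0.
    rest : Functional n
    rest = record
      { at   = λ v → at (0# ∷ v)
      ; at-+ = λ u v → trans (cong at (+-homo 0∷-linear u v)) (f-+ (0# ∷ u) (0# ∷ v))
      ; at-* = λ c v → trans (cong at (*-homo 0∷-linear c v)) (f-* c (0# ∷ v))
      }

    at-∷ : ∀ c v → at (c ∷ v) ≡ c · leading ⊕ Functional.at rest v
    at-∷ c v = begin
      at (c ∷ v)                              ≡⟨ cong at (sym eq) ⟩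
      at (c *ᵛ (1# ∷ 0ᵛ) +ᵛ (0# ∷ v))         ≡⟨ f-+ _ _ ⟩
      at (c *ᵛ (1# ∷ 0ᵛ)) ⊕ at (0# ∷ v)       ≡⟨ cong (_⊕ at (0# ∷ v)) (f-* c (1# ∷ 0ᵛ)) ⟩
      c · leading ⊕ at (0# ∷ v)               ∎
      where
      open ≡-Reasoning
      eq : c *ᵛ (1# ∷ 0ᵛ) +ᵛ (0# ∷ v) ≡ c ∷ v
      eq = cong₂ _∷_ (trans (+-identityʳ _) (*-identityʳ c))
                     (trans (cong (_+ᵛ v) (*ᵛ0 c n)) (+ᵛ-identityˡ v))

    at-∷-0 : leading ≡ 0# → ∀ c v → at (c ∷ v) ≡ Functional.at rest v
    at-∷-0 a≡0 c v = begin
      at (c ∷ v)              ≡⟨ at-∷ c v ⟩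
      c · leading ⊕ g v       ≡⟨ cong (λ a → c · a ⊕ g v) a≡0 ⟩
      c · 0# ⊕ g v            ≡⟨ cong (_⊕ g v) (zeroʳ c) ⟩
      0# ⊕ g v                ≡⟨ +-identityˡ (g v) ⟩
      g v                     ∎
      where
      open ≡-Reasoning
      g = Functional.at rest

    -- If the leading coefficient a has an inverse u, then the equation c a + g v = 0 has
    -- the unique solution c = (-u) g v.
    pivot-kernel : ∀ u → leading · u ≡ 1# → Parametrization (λ v → at v ≡ 0#) n
    pivot-kernel u au≡1 = record
      { map       = λ v → p · g v ∷ v
      ; linear    = record
        { +-homo = λ v w → cong (_∷ v +ᵛ w) (trans (cong (p ·_) (g-+ v w)) (distribˡ p (g v) (g w)))
        ; *-homo = λ c v → cong (_∷ c *ᵛ v) (trans (cong (p ·_) (g-* c v)) (x∙yz≈y∙xz p c (g v)))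
        }
      ; injective = λ _ → Vec.∷-injectiveʳ
      ; sound     = λ v → begin
          at (p · g v ∷ v)        ≡⟨ at-∷ (p · g v) v ⟩
          p · g v · a ⊕ g v       ≡⟨ cong (_⊕ g v) (pga (g v)) ⟩
          ⊖ g v ⊕ g v             ≡⟨ -‿inverseˡ (g v) ⟩
          0#                      ∎
      ; complete  = λ { {c ∷ v} fcv≡0 → v , cong (_∷ v) (begin
          c                       ≡⟨ sym (*-identityʳ c) ⟩
          c · 1#                  ≡⟨ cong (c ·_) (sym au≡1) ⟩
          c · (a · u)             ≡⟨ sym (*-assoc c a u) ⟩
          c · a · u               ≡⟨ cong (_· u) (inverseˡ-unique (c · a) (g v) (trans (sym (at-∷ c v)) fcv≡0)) ⟩
          ⊖ g v · u               ≡⟨ sym (-‿distribˡ-* (g v) u) ⟩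
          ⊖ (g v · u)             ≡⟨ -‿distribʳ-* (g v) u ⟩
          g v · ⊖ u               ≡⟨ *-comm (g v) p ⟩
          p · g v                 ∎) }
      }
      where
      open ≡-Reasoning
      open Functional rest renaming (at to g; at-+ to g-+; at-* to g-*)
      a = leading
      p = ⊖ u
      pga : ∀ x → p · x · a ≡ ⊖ x
      pga x = begin
        p · x · a               ≡⟨ xy∙z≈xz∙y p x a ⟩
        p · a · x               ≡⟨ cong (_· x) (sym (-‿distribˡ-* u a)) ⟩
        ⊖ (u · a) · x           ≡⟨ cong (λ z → ⊖ z · x) (trans (*-comm u a) au≡1) ⟩
        ⊖ 1# · x                ≡⟨ sym (-‿distribˡ-* 1# x) ⟩
        ⊖ (1# · x)              ≡⟨ cong ⊖_ (*-identityˡ x) ⟩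
        ⊖ x                     ∎

  -- The kernel of a nonzero functional on 𝔽^(j+1) has dimension j. If the leading
  -- coefficient is nonzero, the first coordinate is determined by the others. If it is
  -- zero, the first coordinate is free and the rest of the functional is nonzero.
  functional-kernel : ∀ {j} (f : Functional (suc j)) x → Functional.at f x ≢ 0# →
    Parametrization (λ v → Functional.at f v ≡ 0#) j
  functional-kernel f x fx≢0 with Defs._≟_ F (leading f) 0#
  ... | no  a≢0 = let u , au≡1 = inverse (leading f) a≢0 in pivot-kernel f u au≡1
  functional-kernel {zero} f (c ∷ []) fx≢0 | yes a≡0 =
    ⊥-elim (fx≢0 (trans (at-∷-0 f a≡0 c []) (Functional.at-0 (rest f))))
  functional-kernel {suc j} f (c ∷ x) fx≢0 | yes a≡0 = record
    { map       = λ v → head v ∷ map (tail v)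
    ; linear    = record
      { +-homo = λ u v → cong₂ _∷_ (head-+ᵛ u v) (trans (cong map (tail-+ᵛ u v)) (+-homo linear (tail u) (tail v)))
      ; *-homo = λ d v → cong₂ _∷_ (head-*ᵛ d v) (trans (cong map (tail-*ᵛ d v)) (*-homo linear d (tail v)))
      }
    ; injective = λ { (d ∷ v) eq → cong₂ _∷_ (Vec.∷-injectiveˡ eq) (injective v (Vec.∷-injectiveʳ eq)) }
    ; sound     = λ v → trans (at-∷-0 f a≡0 (head v) (map (tail v))) (sound (tail v))
    ; complete  = λ { {d ∷ v} fdv≡0 → let y , v≡ = complete (trans (sym (at-∷-0 f a≡0 d v)) fdv≡0)
                                     in d ∷ y , cong (d ∷_) v≡ }
    }
    where
    open Parametrization (functional-kernel (rest f) x λ gx≡0 → fx≢0 (trans (at-∷-0 f a≡0 c x) gx≡0))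

  -- The kernel of an onto linear map 𝔽^(r+j) → 𝔽^r has dimension j. In the inductive
  -- step, P parametrizes the kernel of the last r coordinates of φ by 𝔽^(j+1), and Q
  -- the kernel of the first coordinate of φ, regarded as a functional on 𝔽^(j+1).
  kernel-parametrization : ∀ r j {n} {φ : 𝔽^ n → 𝔽^ r} → r ℕ.+ j ≡ n → Linear φ →
    (∀ w → ∃[ v ] φ v ≡ w) → Parametrization (kernel φ) j
  kernel-parametrization zero    j {φ = φ} refl lin onto = record
    { map       = id
    ; linear    = record { +-homo = λ _ _ → refl ; *-homo = λ _ _ → refl }
    ; injective = λ _ → id
    ; sound     = λ x → 𝔽⁰ (φ x)
    ; complete  = λ {v} _ → v , refl
    }
    where
    𝔽⁰ : ∀ (v : 𝔽^ 0) → v ≡ 0ᵛ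
    𝔽⁰ [] = refl
  kernel-parametrization (suc r) j {n} {φ} r+j≡n lin onto = record
    { map       = P.map ∘ Q.map
    ; linear    = ∘-linear P.linear Q.linear
    ; injective = λ x eq → Q.injective x (P.injective (Q.map x) eq)
    ; sound     = λ x → ∷-≡0 (φ (P.map (Q.map x))) (Q.sound x) (P.sound (Q.map x))
    ; complete  = λ {v} φv≡0 →
        let x , v≡Px = P.complete (cong tail φv≡0)
            y , x≡Qy = Q.complete (trans (cong (head ∘ φ) (sym v≡Px)) (cong head φv≡0))
        in y , trans v≡Px (cong P.map x≡Qy)
    }
    where
    parametrization-P : Parametrization (kernel (tail ∘ φ)) (suc j)
    parametrization-P = kernel-parametrization r (suc j) (trans (ℕ.+-suc r j) r+j≡n)
      (∘-linear tail-linear lin) (λ w → let v , φv≡ = onto (0# ∷ w) in v , cong tail φv≡)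
    module P = Parametrization parametrization-P
    f : Functional (suc j)
    f = headOf (∘-linear lin P.linear)
    -- A vector mapped to (1,0,…,0) shows that f is nonzero.
    e = onto (1# ∷ 0ᵛ)
    x = P.complete (cong tail (proj₂ e))
    fx≢0 : Functional.at f (proj₁ x) ≢ 0#
    fx≢0 fx≡0 = 0≢1 (trans (sym fx≡0)
      (trans (cong (head ∘ φ) (sym (proj₂ x))) (cong head (proj₂ e))))
    module Q = Parametrization (functional-kernel f (proj₁ x) fx≢0)
    ∷-≡0 : ∀ {n} (v : 𝔽^ (suc n)) → head v ≡ 0# → tail v ≡ 0ᵛ → v ≡ 0ᵛ
    ∷-≡0 (_ ∷ _) = cong₂ _∷_

  kernel-dimension : ∀ {n k} {φ : 𝔽^ n → 𝔽^ (n ℕ.∸ k)} → k ℕ.≤ n → IsLinear φ → IsOnto φ →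
    HasDimension (kernel φ) k
  kernel-dimension {n} {k} k≤n lin onto = parametrization⇒dimension
    (kernel-parametrization (n ℕ.∸ k) k (ℕ.m∸n+n≡m k≤n) (isLinear⇒linear lin)
      (λ w → let v , eq = onto w in v , eq refl))

-- Counting

-- If m distinct terms of a nonnegative sum are at least c, the sum is at least m c.
injection-≤-sum : ∀ {m s} (f : Fin s → ℚ) {c} → (∀ i → 0ℚ ℚ.≤ f i) → (g : Fin m → Fin s) →
  Injective _≡_ _≡_ g → (∀ i → c ℚ.≤ f (g i)) → fromℕ m * c ℚ.≤ sum f
injection-≤-sum {zero}  {s}     f {c} f≥0 g inj c≤ =
  ℚ.≤-trans (ℚ.≤-reflexive (ℚ.*-zeroˡ c)) (sum-nonNeg f f≥0)
injection-≤-sum {suc m} {zero}  f f≥0 g inj c≤ with () ← g zero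
injection-≤-sum {suc m} {suc s} f {c} f≥0 g inj c≤ = begin
  fromℕ (suc m) * c                   ≡⟨ cong (_* c) (fromℕ-suc m) ⟩
  (1ℚ + fromℕ m) * c                  ≡⟨ ℚ.*-distribʳ-+ c 1ℚ (fromℕ m) ⟩
  1ℚ * c + fromℕ m * c                ≡⟨ cong (_+ fromℕ m * c) (ℚ.*-identityˡ c) ⟩
  c + fromℕ m * c                     ≤⟨ ℚ.+-mono-≤ (c≤ zero) ih ⟩
  f (g zero) + sum (f ∘ punchIn (g zero))  ≡⟨ sym (sum-remove {i = g zero} f) ⟩
  sum f                               ∎
  where
  open ℚ.≤-Reasoning
  g₀≢ : ∀ i → g zero ≢ g (suc i)
  g₀≢ i eq with () ← inj eq
  g′ : Fin m → Fin s
  g′ i = punchOut (g₀≢ i)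
  ih : fromℕ m * c ℚ.≤ sum (f ∘ punchIn (g zero))
  ih = injection-≤-sum (f ∘ punchIn (g zero)) (f≥0 ∘ punchIn (g zero)) g′
    (λ {i} {j} eq → Fin.suc-injective (inj (Fin.punchOut-injective (g₀≢ i) (g₀≢ j) eq)))
    (λ i → subst (λ z → c ℚ.≤ f z) (sym (Fin.punchIn-punchOut (g₀≢ i))) (c≤ (suc i)))

lookup-injective : ∀ {A : Set} {xs : List A} → Unique xs → Injective _≡_ _≡_ (List.lookup xs)
lookup-injective (x∉ ∷ u) {zero}  {zero}  eq = refl
lookup-injective (x∉ ∷ u) {zero}  {suc j} eq = ⊥-elim (ListAll.lookup x∉ (∈.∈-lookup j) eq)
lookup-injective (x∉ ∷ u) {suc i} {zero}  eq = ⊥-elim (ListAll.lookup x∉ (∈.∈-lookup i) (sym eq))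
lookup-injective (x∉ ∷ u) {suc i} {suc j} eq = cong suc (lookup-injective u eq)

unique⇒length≤ : ∀ {A : Set} {xs ys : List A} → Unique xs → (∀ {x} → x ∈ xs → x ∈ ys) → length xs ℕ.≤ length ys
unique⇒length≤ {A} {xs} u xs⊆ys = Fin.injective⇒≤ {f = λ i → index (xs⊆ys (∈.∈-lookup {xs = xs} i))}
  λ {i} {j} eq → lookup-injective u
    (∈ˢ.index-injective (setoid A) (xs⊆ys (∈.∈-lookup i)) (xs⊆ys (∈.∈-lookup j)) eq)

length-cartesianProductWith : ∀ {A B C : Set} (f : A → B → C) xs ys →
  length (List.cartesianProductWith f xs ys) ≡ length xs ℕ.* length ys
length-cartesianProductWith f []       ys = refl
length-cartesianProductWith f (x ∷ xs) ys = trans (List.length-++ (List.map (f x) ys))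
  (cong₂ ℕ._+_ (List.length-map (f x) ys) (length-cartesianProductWith f xs ys))

module Counting {q : ℕ} (F : FiniteField q) where
  open FurstenbergSets F
  open LinearAlgebra F

  length-vectors : ∀ n → length (vectors n) ≡ q ℕ.^ n
  length-vectors zero    = refl
  length-vectors (suc n) = trans (length-cartesianProductWith Vec._∷_ (scalars F) (vectors n))
    (cong₂ ℕ._*_ (trans (List.length-map (from F) (List.allFin q)) (List.length-tabulate {n = q} (λ i → i))) (length-vectors n))

  ∣∣≤q^n : ∀ {n} (S : FiniteSubset (𝔽^ n)) → fromℕ ∣ S ∣ ℚ.≤ fromℕ q ^ n
  ∣∣≤q^n {n} S = subst (fromℕ ∣ S ∣ ℚ.≤_) (fromℕ-^ q n) (fromℕ-mono
    (subst (∣ S ∣ ℕ.≤_) (length-vectors n)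
      (unique⇒length≤ (FiniteSubset.unique S) λ {v} _ → ∈-vectors v)))

  -- If m points of S are mapped to w, then the image of U_S takes the value w with
  -- probability at least m / |S|.
  maxPr-fibre : ∀ {n r m} (φ : 𝔽^ n → 𝔽^ r) (S : FiniteSubset (𝔽^ n)) .{{_ : NonZero ∣ S ∣}} w →
    AtLeast m (λ v → φ v ≡ w × v ∈ˢ S) →
    fromℕ m * (+ 1 / ∣ S ∣) ℚ.≤ maxPr (mapRV φ (uniform S))
  maxPr-fibre {n} {r} {m} φ S w (f , mem) = ℚ.≤-trans
    (injection-≤-sum term term≥0 g g-injective c≤term)
    (v≤max⁺ 0ℚ _ (inj₂ (Any.map ℚ.≤-reflexive (∈.∈-map⁺ (Pr _≟ᵛ_ (mapRV φ (uniform S))) (∈-vectors w)))))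
    where
    els = FiniteSubset.elements S
    c = + 1 / ∣ S ∣
    g : Fin m → Fin ∣ S ∣
    g i = index (proj₂ (mem i))
    g-injective : Injective _≡_ _≡_ g
    g-injective {i} {j} eq = Injection.injective f
      (∈ˢ.index-injective (setoid (𝔽^ n)) (proj₂ (mem i)) (proj₂ (mem j)) eq)
    term : Fin ∣ S ∣ → ℚ
    term ω = if does (φ (List.lookup els ω) ≟ᵛ w) then c else 0ℚ
    term≥0 : ∀ ω → 0ℚ ℚ.≤ term ω
    term≥0 ω with φ (List.lookup els ω) ≟ᵛ w
    ... | yes _ = 0≤1/ ∣ S ∣
    ... | no  _ = ℚ.≤-refl
    c≤term : ∀ i → c ℚ.≤ term (g i)
    c≤term i with φ (List.lookup els (g i)) ≟ᵛ w
    ... | yes _   = ℚ.≤-refl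
    ... | no  neq = ⊥-elim (neq (trans (cong φ (sym (lookup-index (proj₂ (mem i))))) (proj₁ (mem i))))

  -- The translate of the kernel given by the Furstenberg property lies in one fibre.
  furstenberg-fibre : ∀ {n k m} {S : FiniteSubset (𝔽^ n)} {φ : 𝔽^ n → 𝔽^ (n ℕ.∸ k)} → k ℕ.≤ n →
    IsFurstenberg k m S → IsLinear φ → IsOnto φ → ∃[ w ] AtLeast m (λ v → φ v ≡ w × v ∈ˢ S)
  furstenberg-fibre {φ = φ} k≤n furst lin onto =
    let a , f , mem = furst (kernel φ) (kernel-isSubspace (isLinear⇒linear lin))
                            (kernel-dimension k≤n lin onto)
    in φ a , f , λ i → translate-fibre (isLinear⇒linear lin) (proj₁ (mem i)) , proj₂ (mem i)

  ∈ˢ⇒nonZero : ∀ {n} {v : 𝔽^ n} (S : FiniteSubset (𝔽^ n)) → v ∈ˢ S → NonZero ∣ S ∣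
  ∈ˢ⇒nonZero S = go (FiniteSubset.elements S)
    where
    go : ∀ {A : Set} {x : A} xs → x ∈ xs → NonZero (length xs)
    go (_ ∷ _) _ = _

  singleton : ∀ {n} → 𝔽^ n → FiniteSubset (𝔽^ n)
  singleton v = record { elements = v ∷ [] ; unique = ListAll.[] ∷ [] }

  -- Statement B applied to S with δ = log_q |S| / n.
  entropyMap : ∀ {n k D} .{{_ : NonZero n}} → StatementB n k D →
    (S : FiniteSubset (𝔽^ n)) .{{_ : NonZero ∣ S ∣}} .{{_ : Positive (fromℕ ∣ S ∣)}} →
    Σ (𝔽^ n → 𝔽^ (n ℕ.∸ k)) λ φ → IsLinear φ × IsOnto φ ×
      (logℝ q (fromℕ ∣ S ∣) ÷ℝ n) *ℝ natℝ (n ℕ.∸ k) -ℝ D ≤ℝ H∞ (mapRV φ (uniform S))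
  entropyMap {n} {k} {D} B S = B δ (0≤logℝ÷ q s n 1≤s) (logℝ÷≤1 q s n (∣∣≤q^n S)) S
    ( (λ {p} ls → ^ℝ-mono q {log} {δ *ℝ natℝ n} (λ {r} → proj₂ (÷ℝ*ℝ log n) {r}) {p}
                    (proj₂ (^ℝ-logℝ q s 1≤s) {p} ls))
    , (λ {p} ls → proj₁ (^ℝ-logℝ q s 1≤s) {p}
                    (^ℝ-mono q {δ *ℝ natℝ n} {log} (λ {r} → proj₁ (÷ℝ*ℝ log n) {r}) {p} ls)))
    where
    s = fromℕ ∣ S ∣
    log = logℝ q s
    δ = log ÷ℝ n
    1≤s : 1ℚ ℚ.≤ s
    1≤s = 1≤fromℕ ∣ S ∣

  ontoMap : ∀ {n k D} .{{_ : NonZero n}} → StatementB n k D →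
    (S : FiniteSubset (𝔽^ n)) .{{_ : NonZero ∣ S ∣}} →
    Σ (𝔽^ n → 𝔽^ (n ℕ.∸ k)) λ φ → IsLinear φ × IsOnto φ
  ontoMap {n} {k} {D} B S =
    let φ , lin , onto , _ = entropyMap {n} {k} {D} B S in φ , lin , onto
    where
    instance
      s>0 : Positive (fromℕ ∣ S ∣)
      s>0 = ℚ.positive (0<fromℕ ∣ S ∣)

  -- The kernel of an onto linear map is a k-dimensional subspace, so some translate of
  -- it meets S in at least m ≥ 1 points.
  furstenberg⇒nonempty : ∀ {n k m} .{{_ : NonZero m}} → k ℕ.≤ n →
    (Σ (𝔽^ n → 𝔽^ (n ℕ.∸ k)) λ φ → IsLinear φ × IsOnto φ) →
    (S : FiniteSubset (𝔽^ n)) → IsFurstenberg k m S → NonZero ∣ S ∣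
  furstenberg⇒nonempty {n} {k} {m@(suc _)} k≤n (φ , lin , onto) S furst =
    let _ , f , mem = furstenberg-fibre {n} {k} {m} {S} k≤n furst lin onto
    in ∈ˢ⇒nonZero S (proj₂ (mem zero))

  entropyMap⇒sizeBound : ∀ n k .{{_ : NonZero n}} .{{_ : NonZero k}} → k < n → ∀ D m .{{_ : NonZero m}}
    (S : FiniteSubset (𝔽^ n)) .{{_ : NonZero ∣ S ∣}} .{{_ : Positive (fromℕ ∣ S ∣)}} →
    IsFurstenberg k m S →
    (Σ (𝔽^ n → 𝔽^ (n ℕ.∸ k)) λ φ → IsLinear φ × IsOnto φ ×
      (logℝ q (fromℕ ∣ S ∣) ÷ℝ n) *ℝ natℝ (n ℕ.∸ k) -ℝ D ≤ℝ H∞ (mapRV φ (uniform S))) →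
    q ^ℝ (-ℝ fromℚ (+ n / k) *ℝ D) *ℝ m ^ℝ fromℚ (+ n / k) ≤ℝ natℝ ∣ S ∣
  entropyMap⇒sizeBound n k k<n D m S furst (φ , lin , onto , bound) =
    let w , fibre = furstenberg-fibre {n} {k} {m} {S} k≤n furst lin onto
    in entropy⇒size q n k (n ℕ.∸ k) (sym (ℕ.m+[n∸m]≡n k≤n)) ∣ S ∣ m D
         (maxPr (mapRV φ (uniform S))) {{maxPr-positive (mapRV φ (uniform S))}}
         (maxPr-fibre φ S w fibre) (λ {p} → bound {p})
    where
    k≤n = ℕ.<⇒≤ k<n
    instance
      n∸k≢0 : NonZero (n ℕ.∸ k)
      n∸k≢0 = ℕ.>-nonZero (ℕ.m<n⇒0<n∸m k<n)

lemma15 : (q : ℕ) → IsPrimePower q → (F : FiniteField q) →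
    (n k : ℕ) → .{{_ : NonZero k}} → k < n →
    (D : ℝ) → 0ℝ ≤ℝ D →
    let open FurstenbergSets F in
    StatementB n k D →
    StatementA n k (q ^ℝ (-ℝ fromℚ (+ n / k) *ℝ D))
lemma15 q _ F n k k<n D _ B m S furst =
  entropyMap⇒sizeBound n k k<n D m S furst (entropyMap {n} {k} {D} B S)
  where
  open FurstenbergSets F
  open Counting F
  instance
    n≢0 : NonZero n
    n≢0 = ℕ.>-nonZero (ℕ.≤-<-trans ℕ.z≤n k<n)
    -- Statement B is applied here to a singleton, as it needs a nonempty set.
    S≢∅ : NonZero ∣ S ∣
    S≢∅ = furstenberg⇒nonempty {n} {k} {m} (ℕ.<⇒≤ k<n) (ontoMap {n} {k} {D} B (singleton 0ᵛ)) S furst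
    s>0 : Positive (fromℕ ∣ S ∣)
    s>0 = ℚ.positive (0<fromℕ ∣ S ∣)
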